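{- For all extended configurations $\mathcal C_1,\mathcal C_2$: $\mathcal C_1\approx_{\mathsf{Canco}}\mathcal C_2$ if and only if $\mathcal L_{\mathsf{Canco}}(\mathcal C_1)=\mathcal L_{\mathsf{Canco}}(\mathcal C_2)$.
   Context: LANGUAGE. $\mathsf{Act}$ is an infinite set of actions with CCS complementation ($\bar{\bar a}=a$); $\tau\notin\mathsf{Act}$; $\mu$ ranges over $\mathsf{Act}\cup\{\tau\}$. Transaction names: $\mathsf{TrN}=\mathsf{inTrN}\uplus\mathsf{exTrN}$ (internal and external names, both infinite). Terms: $P,Q::=\sum_{i\in J}\mu_i.P_i$ ($J$ countable; $\mathbf 0$ is the empty sum) $\mid P\mid Q\mid\nu a.P\mid X\mid\mathrm{rec}X.P\mid[\![P\triangleright_kQ]\!]$ (running transaction named $k$) $\mid\mathrm{co}\mid[\![P\blacktriangleright Q]\!]$ (dormant transaction). $ftn(o)$ is the set of transaction names in $o$; $o\,\sharp\,o'$ means no transaction name of $o$ occurs in $o'$. A process is a well-formed term: (1) it is closed (no free process variables); (2) $ftn$ of it is finite; and for all subterms $[\![P_1\triangleright_kP_1']\!]$, $[\![P_2\blacktriangleright P_2']\!]$, $\sum\mu_i.Q_i$, $\mathrm{rec}X.R$: (3) $P_1,P_1',P_2,P_2',Q_i,R$ contain no transaction names; (4) $P_1,P_2,Q_i$ contain no dormant transactions; (5) $P_1,P_2$ are closed. PROCESS TRANSITIONS. $P\xrightarrow{\alpha}_\sigma Q$ with $\alpha\in\{a,\tau,k(\tau),k(a)\}$ and $\sigma$ a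 name substitution $\tilde k\mapsto l$ (domain the finite tuple $\tilde k$, possibly empty, range $\{l\}$; $\varepsilon$ alone is the empty substitution). Rules (symmetric ones omitted): - $\sum\mu_i.P_i\xrightarrow{\mu_j}_\varepsilon P_j$; - if $P\xrightarrow{a}_\varepsilon P'$ and $Q\xrightarrow{\bar a}_\varepsilon Q'$ then $P\mid Q\xrightarrow{\tau}_\varepsilon P'\mid Q'$; - $\mathrm{rec}X.P\xrightarrow{\tau}_\varepsilon P[\mathrm{rec}X.P/X]$; - if $\mu_j=a$ then $\sum\mu_i.P_i\xrightarrow{k(a)}_{\varepsilon\mapsto k}[\![P_j\mid\mathrm{co}\triangleright_k\sum\mu_i.P_i]\!]$; - if $P\xrightarrow{\mu}_\varepsilon P'$ and $k\,\sharp\,l$ then $[\![P\triangleright_lQ]\!]\xrightarrow{k(\mu)}_{l\mapsto k}[\![P'\triangleright_kQ]\!]$; - if $P\xrightarrow{k(a)}_{\sigma_1}P'$, $Q\xrightarrow{k(\bar a)}_{\sigma_2}Q'$, $\sigma_i=\tilde l_i\mapsto k$, then $P\mid Q\xrightarrow{k(\tau)}_{(\tilde l_1,\tilde l_2)\mapsto k}P'\sigma_2\mid Q'\sigma_1$; - if $P\xrightarrow{\alpha}_\sigma P'$ and $range(\sigma)\,\sharp\,Q$ then $P\mid Q\xrightarrow{\alpha}_\sigma P'\mid Q\sigma$; - if $P\xrightarrow{\alpha}_\sigma P'$ and $a$ does not occur in $\alpha$ then $\nu a.P\xrightarrow{\alpha}_\sigma\nu a.P'$. Reconfiguration transitions $P\xrightarrow{\beta}Q$,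 $\beta\in\{\mathrm{co}\,k,\mathrm{ab}\,k,\mathrm{new}\,k\}$ (symmetric rules omitted): - if $P\equiv\mathrm{co}\mid P''$ for some $P''$ and $P\rightsquigarrow_{\mathrm{co}}P'$ then $[\![P\triangleright_kQ]\!]\xrightarrow{\mathrm{co}\,k}P'$; - $[\![P\blacktriangleright Q]\!]\xrightarrow{\mathrm{new}\,k}[\![P\triangleright_kQ]\!]$; - $[\![P\triangleright_kQ]\!]\xrightarrow{\mathrm{ab}\,k}Q$; - for $\beta=\mathrm{co}\,k$ or $\mathrm{ab}\,k$: if $P\xrightarrow{\beta}P'$ and $Q\xrightarrow{\beta}Q'$ then $P\mid Q\xrightarrow{\beta}P'\mid Q'$; - if $P\xrightarrow{\beta}P'$ and $\beta\,\sharp\,Q$ then $P\mid Q\xrightarrow{\beta}P'\mid Q$; - if $P\xrightarrow{\beta}P'$ then $\nu a.P\xrightarrow{\beta}\nu a.P'$. Here $\equiv$ is standard CCS structural equivalence extended to transactions, and $\rightsquigarrow_{\mathrm{co}}$ is given by: $\mathrm{co}\rightsquigarrow_{\mathrm{co}}\mathbf 0$; sums, variables, $\mathrm{rec}X.P$ and $[\![P\blacktriangleright Q]\!]$ are related to themselves; it is compatible with $\nu a.-$ and $-\mid-$. EXTENDED CONFIGURATIONS. $I$ is a countable index set. An extended configuration is $\langle E;H\bullet P\rangle$ with $P$ a process, $E$ an equivalence relation over a finite subset of $\mathsf{TrN}$, and $H$ a finite partial function from $I$ to $\{k(a),k(\mathrm{ab}),k(\mathrm{co})\mid k\in\mathsf{exTrN},a\in\mathsf{Act}\}$.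 Let $H^{\mathrm{trn}}(i)$ be the name used in $H(i)$, $H^{\mathrm{trn}}$ the set of all these, and $\mathrm{Hasco}(H)=\{k\mid\exists i.\,H(i)=k(\mathrm{co})\}$. It is required that: (i) $H^{\mathrm{trn}}(i)=H^{\mathrm{trn}}(j)$ implies $i=j$; (ii) for $k\in\mathsf{exTrN}$, $k\,E\,k$ iff $k\in H^{\mathrm{trn}}$, and $k\,E\,k'$ implies ($k\in\mathrm{Hasco}(H)$ iff $k'\in\mathrm{Hasco}(H)$); (iii) $ftn(P)\cap\mathrm{Hasco}(H)=\emptyset$; (iv) $k\,E\,k'$ and $k,k'\in ftn(P)$ imply $k=k'$. Convention: external names of a configuration are those in its history, i.e. $ftn(P)\cap\mathsf{exTrN}\subseteq H^{\mathrm{trn}}$. "$H,k(a)$" denotes $H$ extended at a new index. For $\sigma=\tilde k\mapsto l$, $\sigma(E)$ is the smallest equivalence relation $F\supseteq E$ with $l\,F\,l$ and $k\,F\,l$ for all $k\in dom(\sigma)$. $(E;H)\setminus_{\mathrm{co}}k$ (resp. $\setminus_{\mathrm{ab}}k$) keeps $E$ and, for every $k'\,E\,k$, changes each $k'(a)$ in $H$ to $k'(\mathrm{co})$ (resp. $k'(\mathrm{ab})$). COMMIT-SENSITIVE TRANSITIONS AND $\approx_{\mathsf{Canco}}$. Let $E_{ext}(k)=\{k'\in\mathsf{exTrN}\mid k\,E\,k'\}$. With $\Delta=E;H$, the commit-sensitive transitions between extended configurations are: - $\langle\Delta\bullet P\rangle\xrightarrow{\tau}_c\langle\Delta\bullet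 Q\rangle$ if $P\xrightarrow{\tau}_\varepsilon Q$; - $\xrightarrow{\tau}_c\langle\sigma(E);H\bullet Q\rangle$ if $P\xrightarrow{k(\tau)}_\sigma Q$, $k\,\sharp\,\Delta$, $k\in\mathsf{inTrN}$; - $\xrightarrow{\tau}_c\langle\Delta\bullet Q\rangle$ if $P\xrightarrow{\mathrm{new}\,k}Q$, $k\,\sharp\,\Delta$, $k\in\mathsf{inTrN}$; - $\xrightarrow{\mathrm{co}(E_{ext}(k))}_c\langle\Delta\setminus_{\mathrm{co}}k\bullet Q\rangle$ if $P\xrightarrow{\mathrm{co}\,k}Q$ and $E_{ext}(k)\neq\emptyset$; - $\xrightarrow{\tau}_c\langle\Delta\setminus_{\mathrm{co}}k\bullet Q\rangle$ if $P\xrightarrow{\mathrm{co}\,k}Q$ and $E_{ext}(k)=\emptyset$; - $\xrightarrow{\tau}_c\langle\Delta\setminus_{\mathrm{ab}}k\bullet Q\rangle$ if $P\xrightarrow{\mathrm{ab}\,k}Q$; - $\xrightarrow{k(a)}_c\langle\sigma(E);H,k(a)\bullet Q\rangle$ if $P\xrightarrow{k(a)}_\sigma Q$, $k\,\sharp\,\Delta$, $k\in\mathsf{exTrN}$; - $\xrightarrow{k(a)}_c\langle E\cup(k,k);H,k(\mathrm{ab})\bullet P\rangle$ if $k\,\sharp\,\Delta$, $k\in\mathsf{exTrN}$. $\stackrel{\tau}{\Rightarrow}_c$ is $(\xrightarrow{\tau}_c)^*$ and $\stackrel{\zeta}{\Rightarrow}_c$ is $\stackrel{\tau}{\Rightarrow}_c\xrightarrow{\zeta}_c\stackrel{\tau}{\Rightarrow}_c$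 otherwise. A relation $\mathcal R$ on extended configurations is a commit-sensitive bisimulation if $\mathcal C_1\mathcal R\mathcal C_2$ implies: (i) for $\zeta\in\{\tau,k(a)\}$, if $\mathcal C_1\stackrel{\zeta}{\Rightarrow}_c\mathcal C_1'$ with $\zeta\,\sharp\,\mathcal C_2$ then $\mathcal C_2\stackrel{\zeta}{\Rightarrow}_c\mathcal C_2'$ for some $\mathcal C_2'$ with $\mathcal C_1'\mathcal R\mathcal C_2'$; (ii) for $K\subseteq\mathsf{exTrN}$, if $\mathcal C_1\stackrel{\mathrm{co}(K)}{\Rightarrow}_c\mathcal C_1'$ then $\mathcal C_2\stackrel{\mathrm{co}(K)}{\Rightarrow}_c\mathcal C_2'$ for some $\mathcal C_2'$ with $\mathcal C_1'\mathcal R\mathcal C_2'$; (iii) the converses. $\approx_{\mathsf{Canco}}$ is the largest one. LOGIC $\mathcal L_{\mathsf{Canco}}$. $\mathsf{Var}$ is a countable set of variables disjoint from $\mathsf{exTrN}$. Formulae: $\phi::=\langle\tau\rangle\phi\mid\langle x(a)\rangle\phi\mid\neg\phi\mid\bigwedge_{i\in M}\phi_i$ ($M$ an arbitrary index set) $\mid\langle\mathrm{co}(K)\rangle\phi$, with $x\in\mathsf{Var}$, $a\in\mathsf{Act}$, $\emptyset\neq K\subseteq\mathsf{exTrN}\uplus\mathsf{Var}$; $\langle x(a)\rangle\phi$ binds $x$ in $\phi$; closed formulae have no free variables. Satisfaction for closed formulae: $\mathcal C\models\langle\mathrm{co}(K)\rangle\phi$ iff $\mathcal C\stackrel{\mathrm{co}(K)}{\Rightarrow}_c\mathcal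 C'$ with $\mathcal C'\models\phi$ for some $\mathcal C'$; $\mathcal C\models\langle\tau\rangle\phi$ iff $\mathcal C\stackrel{\tau}{\Rightarrow}_c\mathcal C'$ with $\mathcal C'\models\phi$ for some $\mathcal C'$; $\mathcal C\models\langle x(a)\rangle\phi$ iff there is a cofinite $N\subseteq\mathsf{exTrN}$ such that for all $l\in N$ there is $\mathcal C'$ with $\mathcal C\stackrel{l(a)}{\Rightarrow}_c\mathcal C'$ and $\mathcal C'\models\phi[l/x]$; conjunction and negation are standard. $\mathcal L_{\mathsf{Canco}}(\mathcal C)$ is the set of closed $\phi$ with $\mathcal C\models\phi$. -}

module Defs where

open import Level using (0ℓ)
open import Data.Bool using (Bool; not)
open import Data.Empty using (⊥)
open import Data.Fin using (Fin; zero; suc)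
open import Data.List using (List; []; _∷_; _++_)
open import Data.List.Membership.Propositional using (_∈_; _∉_)
import Data.List.Membership.DecPropositional as DecMembership
open import Data.Maybe using (Maybe; just; nothing)
open import Data.Nat using (ℕ; zero; suc)
open import Data.Product using (∃; ∃₂; _×_; _,_)
import Data.Product as Product
open import Data.Sum using (_⊎_; inj₁; inj₂; [_,_]′)
import Data.Sum as Sum
open import Data.Sum.Properties using (≡-dec)
open import Data.Unit using (⊤)
open import Function using (_∘_; id)
open import Function.Bundles using (_↣_; _↔_; Inverse; mk↣; _⇔_; mk⇔)
open import Relation.Binary.Construct.Closure.ReflexiveTransitive using (Star)
open import Relation.Binary.Core using (Rel) renaming (_⇔_ to _⇔ᴿ_)
open import Relation.Binary.Definitions using (DecidableEquality)
open import Relation.Binary.PropositionalEquality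
  using (_≡_; _≢_; _≗_; refl; sym; trans)
open import Relation.Binary.Structures using (IsPartialEquivalence)
open import Relation.Nullary using (¬_; yes; no)
open import Relation.Unary using (Pred; ∁; _≐_)

Finite : {A : Set} → Pred A 0ℓ → Set
Finite {A} N = ∃ λ (xs : List A) → ∀ x → N x → x ∈ xs

Infinite : Set → Set
Infinite A = (xs : List A) → ∃ λ (x : A) → x ∉ xs

Cofinite : {A : Set} → Pred A 0ℓ → Set
Cofinite N = Finite (∁ N)

-- Decidability of name equality is used to compute name substitutions.
record Signature : Set₁ where
  field
    Act            : Set
    bar            : Act → Act
    bar-involutive : ∀ a → bar (bar a) ≡ a
    Act-infinite   : Infinite Act
    InTrN ExTrN    : Set
    InTrN-infinite : Infinite InTrN
    ExTrN-infinite : Infinite ExTrN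
    _≟ⁱ_           : DecidableEquality InTrN
    _≟ᵉ_           : DecidableEquality ExTrN
    I              : Set
    I-countable    : I ↣ ℕ

module Calculus (S : Signature) where
  open Signature S

  TrN : Set
  TrN = InTrN ⊎ ExTrN

  pattern int k = inj₁ k
  pattern ext k = inj₂ k

  _≟_ : DecidableEquality TrN
  _≟_ = ≡-dec _≟ⁱ_ _≟ᵉ_

  open DecMembership _≟_ using (_∈?_)

  -- Restricted action names and process variables are de Bruijn
  -- indices, so terms are taken up to α-conversion and substitution
  -- avoids capture: a `Term m n` has m restricted names and n process
  -- variables in scope.

  -- The Boolean is the polarity: `bound i b` and `bound i (not b)` are
  -- the two complementary actions on the i-th restricted name.
  data Action (m : ℕ) : Set where
    free  : Act → Action m
    bound : Fin m → Bool → Action m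

  complement : ∀ {m} → Action m → Action m
  complement (free a)    = free (bar a)
  complement (bound i b) = bound i (not b)

  data Prefix (m : ℕ) : Set where
    τ   : Prefix m
    act : Action m → Prefix m

  infixr 5 _∣_
  infix  6 ⟦_▷[_]_⟧ ⟦_▶_⟧

  data Term (m n : ℕ) : Set₁ where
    ∑       : {J : Set} → J ↣ ℕ → (J → Prefix m) → (J → Term m n) → Term m n
    _∣_     : Term m n → Term m n → Term m n
    ν       : Term (suc m) n → Term m n
    var     : Fin n → Term m n
    rec     : Term m (suc n) → Term m n
    ⟦_▷[_]_⟧ : Term m n → TrN → Term m n → Term m n
    co      : Term m n
    ⟦_▶_⟧   : Term m n → Term m n → Term m n

  𝟎 : ∀ {m n} → Term m n
  𝟎 = ∑ {J = ⊥} (mk↣ {to = λ ()} (λ { {()} })) (λ ()) (λ ())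

  lift : ∀ {m m'} → (Fin m → Fin m') → Fin (suc m) → Fin (suc m')
  lift r zero    = zero
  lift r (suc i) = suc (r i)

  renAction : ∀ {m m'} → (Fin m → Fin m') → Action m → Action m'
  renAction r (free a)    = free a
  renAction r (bound i b) = bound (r i) b

  renPrefix : ∀ {m m'} → (Fin m → Fin m') → Prefix m → Prefix m'
  renPrefix r τ       = τ
  renPrefix r (act a) = act (renAction r a)

  ren : ∀ {m m' n n'} → (Fin m → Fin m') → (Fin n → Fin n') → Term m n → Term m' n'
  ren r s (∑ c μ P)      = ∑ c (λ j → renPrefix r (μ j)) (λ j → ren r s (P j))
  ren r s (P ∣ Q)        = ren r s P ∣ ren r s Q
  ren r s (ν P)          = ν (ren (lift r) s P)
  ren r s (var x)        = var (s x)
  ren r s (rec P)        = rec (ren r (lift s) P)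
  ren r s ⟦ P ▷[ k ] Q ⟧ = ⟦ ren r s P ▷[ k ] ren r s Q ⟧
  ren r s co             = co
  ren r s ⟦ P ▶ Q ⟧      = ⟦ ren r s P ▶ ren r s Q ⟧

  weakenAct : ∀ {m n} → Term m n → Term (suc m) n
  weakenAct = ren suc id

  liftSubst : ∀ {m n n'} → (Fin n → Term m n') → Fin (suc n) → Term m (suc n')
  liftSubst θ zero    = var zero
  liftSubst θ (suc x) = ren id suc (θ x)

  subst : ∀ {m n n'} → (Fin n → Term m n') → Term m n → Term m n'
  subst θ (∑ c μ P)      = ∑ c μ (λ j → subst θ (P j))
  subst θ (P ∣ Q)        = subst θ P ∣ subst θ Q
  subst θ (ν P)          = ν (subst (weakenAct ∘ θ) P)
  subst θ (var x)        = θ x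
  subst θ (rec P)        = rec (subst (liftSubst θ) P)
  subst θ ⟦ P ▷[ k ] Q ⟧ = ⟦ subst θ P ▷[ k ] subst θ Q ⟧
  subst θ co             = co
  subst θ ⟦ P ▶ Q ⟧      = ⟦ subst θ P ▶ subst θ Q ⟧

  infix 8 _[_/X]
  _[_/X] : ∀ {m n} → Term m (suc n) → Term m n → Term m n
  P [ Q /X] = subst (λ { zero → Q ; (suc x) → var x }) P

  infix 4 _∈ftn_
  _∈ftn_ : ∀ {m n} → TrN → Term m n → Set
  k ∈ftn ∑ _ _ P        = ∃ λ j → k ∈ftn P j
  k ∈ftn (P ∣ Q)        = k ∈ftn P ⊎ k ∈ftn Q
  k ∈ftn ν P            = k ∈ftn P
  k ∈ftn var x          = ⊥
  k ∈ftn rec P          = k ∈ftn P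
  k ∈ftn ⟦ P ▷[ l ] Q ⟧ = k ≡ l ⊎ k ∈ftn P ⊎ k ∈ftn Q
  k ∈ftn co             = ⊥
  k ∈ftn ⟦ P ▶ Q ⟧      = k ∈ftn P ⊎ k ∈ftn Q

  NoTrN : ∀ {m n} → Term m n → Set
  NoTrN P = ∀ k → ¬ (k ∈ftn P)

  NoDormant : ∀ {m n} → Term m n → Set
  NoDormant (∑ _ _ P)        = ∀ j → NoDormant (P j)
  NoDormant (P ∣ Q)          = NoDormant P × NoDormant Q
  NoDormant (ν P)            = NoDormant P
  NoDormant (var x)          = ⊤
  NoDormant (rec P)          = NoDormant P
  NoDormant ⟦ P ▷[ _ ] Q ⟧   = NoDormant P × NoDormant Q
  NoDormant co               = ⊤
  NoDormant ⟦ P ▶ Q ⟧        = ⊥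

  infix 4 _∈fpv_
  _∈fpv_ : ∀ {m n} → Fin n → Term m n → Set
  x ∈fpv ∑ _ _ P        = ∃ λ j → x ∈fpv P j
  x ∈fpv (P ∣ Q)        = x ∈fpv P ⊎ x ∈fpv Q
  x ∈fpv ν P            = x ∈fpv P
  x ∈fpv var y          = x ≡ y
  x ∈fpv rec P          = suc x ∈fpv P
  x ∈fpv ⟦ P ▷[ _ ] Q ⟧ = x ∈fpv P ⊎ x ∈fpv Q
  x ∈fpv co             = ⊥
  x ∈fpv ⟦ P ▶ Q ⟧      = x ∈fpv P ⊎ x ∈fpv Q

  Closed : ∀ {m n} → Term m n → Set
  Closed P = ∀ x → ¬ (x ∈fpv P)

  Subterms-ok : ∀ {m n} → Term m n → Set
  Subterms-ok (∑ _ _ P)      =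
    ∀ j → NoTrN (P j) × NoDormant (P j) × Subterms-ok (P j)
  Subterms-ok (P ∣ Q)        = Subterms-ok P × Subterms-ok Q
  Subterms-ok (ν P)          = Subterms-ok P
  Subterms-ok (var x)        = ⊤
  Subterms-ok (rec P)        = NoTrN P × Subterms-ok P
  Subterms-ok ⟦ P ▷[ _ ] Q ⟧ =
    NoTrN P × NoTrN Q × NoDormant P × Closed P × Subterms-ok P × Subterms-ok Q
  Subterms-ok co             = ⊤
  Subterms-ok ⟦ P ▶ Q ⟧      =
    NoTrN P × NoTrN Q × NoDormant P × Closed P × Subterms-ok P × Subterms-ok Q

  IsProcess : Term 0 0 → Set
  IsProcess P = Closed P × Finite (_∈ftn P) × Subterms-ok P

  -- `ε` is the empty substitution, with empty range;
  -- `[] ↦ l` also acts as the identity but has range {l}.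

  infix 7 _↦_
  data NameSubst : Set where
    ε   : NameSubst
    _↦_ : List TrN → TrN → NameSubst

  infix 4 _∈dom_ _∈range_
  _∈dom_ : TrN → NameSubst → Set
  k ∈dom ε        = ⊥
  k ∈dom (ks ↦ l) = k ∈ ks

  _∈range_ : TrN → NameSubst → Set
  k ∈range ε        = ⊥
  k ∈range (ks ↦ l) = k ≡ l

  applyName : NameSubst → TrN → TrN
  applyName ε        k = k
  applyName (ks ↦ l) k with k ∈? ks
  ... | yes _ = l
  ... | no  _ = k

  infixl 8 _⟪_⟫
  _⟪_⟫ : ∀ {m n} → Term m n → NameSubst → Term m n
  (∑ c μ P) ⟪ σ ⟫      = ∑ c μ (λ j → P j ⟪ σ ⟫)
  (P ∣ Q) ⟪ σ ⟫        = P ⟪ σ ⟫ ∣ Q ⟪ σ ⟫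
  (ν P) ⟪ σ ⟫          = ν (P ⟪ σ ⟫)
  (var x) ⟪ σ ⟫        = var x
  (rec P) ⟪ σ ⟫        = rec (P ⟪ σ ⟫)
  ⟦ P ▷[ k ] Q ⟧ ⟪ σ ⟫ = ⟦ P ⟪ σ ⟫ ▷[ applyName σ k ] Q ⟪ σ ⟫ ⟧
  co ⟪ σ ⟫             = co
  ⟦ P ▶ Q ⟧ ⟪ σ ⟫      = ⟦ P ⟪ σ ⟫ ▶ Q ⟪ σ ⟫ ⟧

  swap₀₁ : ∀ {m} → Fin (suc (suc m)) → Fin (suc (suc m))
  swap₀₁ zero          = suc zero
  swap₀₁ (suc zero)    = zero
  swap₀₁ (suc (suc i)) = suc (suc i)

  -- The least congruence containing the commutative monoid laws for
  -- parallel composition, reordering of summands, and the laws of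
  -- restriction.  In the extrusion law the side condition that the
  -- restricted name is not free in Q is expressed by weakening.
  infix 4 _≋_
  data _≋_ {m n : ℕ} : Term m n → Term m n → Set₁ where
    ≋-refl  : ∀ {P} → P ≋ P
    ≋-sym   : ∀ {P Q} → P ≋ Q → Q ≋ P
    ≋-trans : ∀ {P Q R} → P ≋ Q → Q ≋ R → P ≋ R

    ∣-identity : ∀ {P} → P ∣ 𝟎 ≋ P
    ∣-comm     : ∀ {P Q} → P ∣ Q ≋ Q ∣ P
    ∣-assoc    : ∀ {P Q R} → (P ∣ Q) ∣ R ≋ P ∣ (Q ∣ R)
    ν-𝟎        : ν 𝟎 ≋ 𝟎
    ν-ν        : ∀ {P} → ν (ν P) ≋ ν (ν (ren swap₀₁ id P))
    ν-extrude  : ∀ {P Q} → ν (P ∣ weakenAct Q) ≋ ν P ∣ Q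

    ∑-cong : ∀ {J J' : Set} {c : J ↣ ℕ} {c' : J' ↣ ℕ} {μ μ' P P'} (e : J ↔ J') →
             (∀ j → μ j ≡ μ' (Inverse.to e j)) →
             (∀ j → P j ≋ P' (Inverse.to e j)) →
             ∑ c μ P ≋ ∑ c' μ' P'
    ∣-cong : ∀ {P P' Q Q'} → P ≋ P' → Q ≋ Q' → P ∣ Q ≋ P' ∣ Q'
    ν-cong : ∀ {P P'} → P ≋ P' → ν P ≋ ν P'
    rec-cong : ∀ {P P'} → P ≋ P' → rec P ≋ rec P'
    ▷-cong : ∀ {P P' k Q Q'} → P ≋ P' → Q ≋ Q' →
             ⟦ P ▷[ k ] Q ⟧ ≋ ⟦ P' ▷[ k ] Q' ⟧
    ▶-cong : ∀ {P P' Q Q'} → P ≋ P' → Q ≋ Q' → ⟦ P ▶ Q ⟧ ≋ ⟦ P' ▶ Q' ⟧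

  data Label (m : ℕ) : Set where
    plain : Prefix m → Label m
    _⟨_⟩  : TrN → Prefix m → Label m

  weakenLabel : ∀ {m} → Label m → Label (suc m)
  weakenLabel (plain μ)  = plain (renPrefix suc μ)
  weakenLabel (k ⟨ μ ⟩)  = k ⟨ renPrefix suc μ ⟩

  infix 3 _—[_∣_]→_
  data _—[_∣_]→_ {m : ℕ} : Term m 0 → Label m → NameSubst → Term m 0 → Set₁ where
    sum : ∀ {J} {c : J ↣ ℕ} {μ P} (j : J) →
          ∑ c μ P —[ plain (μ j) ∣ ε ]→ P j

    sync : ∀ {P P' Q Q' a} →
           P —[ plain (act a) ∣ ε ]→ P' →
           Q —[ plain (act (complement a)) ∣ ε ]→ Q' →
           P ∣ Q —[ plain τ ∣ ε ]→ P' ∣ Q'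

    unfold : ∀ {P} → rec P —[ plain τ ∣ ε ]→ P [ rec P /X]

    tr-sum : ∀ {J} {c : J ↣ ℕ} {μ P a k} (j : J) → μ j ≡ act a →
             ∑ c μ P —[ k ⟨ act a ⟩ ∣ [] ↦ k ]→ ⟦ P j ∣ co ▷[ k ] ∑ c μ P ⟧

    tr-run : ∀ {P P' Q μ k l} →
             P —[ plain μ ∣ ε ]→ P' → k ≢ l →
             ⟦ P ▷[ l ] Q ⟧ —[ k ⟨ μ ⟩ ∣ (l ∷ []) ↦ k ]→ ⟦ P' ▷[ k ] Q ⟧

    tr-sync : ∀ {P P' Q Q' a k ls₁ ls₂} →
              P —[ k ⟨ act a ⟩ ∣ ls₁ ↦ k ]→ P' →
              Q —[ k ⟨ act (complement a) ⟩ ∣ ls₂ ↦ k ]→ Q' →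
              P ∣ Q —[ k ⟨ τ ⟩ ∣ (ls₁ ++ ls₂) ↦ k ]→ P' ⟪ ls₂ ↦ k ⟫ ∣ Q' ⟪ ls₁ ↦ k ⟫

    parˡ : ∀ {P P' Q α σ} →
           P —[ α ∣ σ ]→ P' → (∀ k → k ∈range σ → ¬ (k ∈ftn Q)) →
           P ∣ Q —[ α ∣ σ ]→ P' ∣ Q ⟪ σ ⟫

    parʳ : ∀ {P Q Q' α σ} →
           Q —[ α ∣ σ ]→ Q' → (∀ k → k ∈range σ → ¬ (k ∈ftn P)) →
           P ∣ Q —[ α ∣ σ ]→ P ⟪ σ ⟫ ∣ Q'

    -- The weakened label does not mention the restricted name.
    res : ∀ {P P' α σ} →
          P —[ weakenLabel α ∣ σ ]→ P' →
          ν P —[ α ∣ σ ]→ ν P'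

  infix 4 _⇝co_
  data _⇝co_ {m n : ℕ} : Term m n → Term m n → Set₁ where
    ⇝-co      : co ⇝co 𝟎
    ⇝-sum     : ∀ {J} {c : J ↣ ℕ} {μ P} → ∑ c μ P ⇝co ∑ c μ P
    ⇝-var     : ∀ {x} → var x ⇝co var x
    ⇝-rec     : ∀ {P} → rec P ⇝co rec P
    ⇝-dormant : ∀ {P Q} → ⟦ P ▶ Q ⟧ ⇝co ⟦ P ▶ Q ⟧
    ⇝-ν       : ∀ {P P'} → P ⇝co P' → ν P ⇝co ν P'
    ⇝-∣       : ∀ {P P' Q Q'} → P ⇝co P' → Q ⇝co Q' → P ∣ Q ⇝co P' ∣ Q'

  data Reconf : Set where
    co ab new : TrN → Reconf

  nameOf : Reconf → TrN
  nameOf (co k)  = k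
  nameOf (ab k)  = k
  nameOf (new k) = k

  data IsEnd : Reconf → Set where
    co : ∀ {k} → IsEnd (co k)
    ab : ∀ {k} → IsEnd (ab k)

  infix 3 _—⟦_⟧→_
  data _—⟦_⟧→_ {m : ℕ} : Term m 0 → Reconf → Term m 0 → Set₁ where
    commit : ∀ {P P' P'' k Q} → P ≋ co ∣ P'' → P ⇝co P' →
             ⟦ P ▷[ k ] Q ⟧ —⟦ co k ⟧→ P'
    start  : ∀ {P Q k} → ⟦ P ▶ Q ⟧ —⟦ new k ⟧→ ⟦ P ▷[ k ] Q ⟧
    abort  : ∀ {P Q k} → ⟦ P ▷[ k ] Q ⟧ —⟦ ab k ⟧→ Q
    both   : ∀ {P P' Q Q' β} → IsEnd β →
             P —⟦ β ⟧→ P' → Q —⟦ β ⟧→ Q' → P ∣ Q —⟦ β ⟧→ P' ∣ Q'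
    parˡ   : ∀ {P P' Q β} → P —⟦ β ⟧→ P' → ¬ (nameOf β ∈ftn Q) →
             P ∣ Q —⟦ β ⟧→ P' ∣ Q
    parʳ   : ∀ {P Q Q' β} → Q —⟦ β ⟧→ Q' → ¬ (nameOf β ∈ftn P) →
             P ∣ Q —⟦ β ⟧→ P ∣ Q'
    res    : ∀ {P P' β} → P —⟦ β ⟧→ P' → ν P —⟦ β ⟧→ ν P'

  data Status : Set where
    act   : Act → Status
    ab co : Status

  History : Set
  History = I → Maybe (ExTrN × Status)

  infix 4 _∈Hᵗʳⁿ_ _∈Hasco_
  _∈Hᵗʳⁿ_ : TrN → History → Set
  int k ∈Hᵗʳⁿ H = ⊥
  ext k ∈Hᵗʳⁿ H = ∃₂ λ i s → H i ≡ just (k , s)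

  _∈Hasco_ : TrN → History → Set
  int k ∈Hasco H = ⊥
  ext k ∈Hasco H = ∃ λ i → H i ≡ just (k , co)

  -- An equivalence relation over a finite subset of TrN is a partial
  -- equivalence relation on TrN whose domain {k | k E k} is finite.
  -- In `E-hasco` both names are external: internal names never occur in H,
  -- but may share a class with external ones that have committed.
  record Config : Set₁ where
    field
      E : Rel TrN 0ℓ
      H : History
      P : Term 0 0

      E-equiv    : IsPartialEquivalence E
      E-finite   : Finite (λ k → E k k)
      H-finite   : Finite (λ i → H i ≢ nothing)
      P-process  : IsProcess P

      H-distinct : ∀ {i j k s t} → H i ≡ just (k , s) → H j ≡ just (k , t) → i ≡ j
      E-dom      : ∀ k → E (ext k) (ext k) ⇔ (ext k ∈Hᵗʳⁿ H)
      E-hasco    : ∀ {k k'} → E (ext k) (ext k') →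
                   (ext k ∈Hasco H) ⇔ (ext k' ∈Hasco H)
      P-hasco    : ∀ k → k ∈ftn P → ¬ (k ∈Hasco H)
      P-separate : ∀ {k k'} → E k k' → k ∈ftn P → k' ∈ftn P → k ≡ k'
      P-external : ∀ k → ext k ∈ftn P → ext k ∈Hᵗʳⁿ H

  open Config

  infix 4 _♯Δ_ _♯_
  _♯Δ_ : TrN → Config → Set
  k ♯Δ C = (∀ k' → ¬ E C k k') × ¬ (k ∈Hᵗʳⁿ H C)

  _♯_ : TrN → Config → Set
  k ♯ C = k ♯Δ C × ¬ (k ∈ftn P C)

  data Apply (σ : NameSubst) (R : Rel TrN 0ℓ) : Rel TrN 0ℓ where
    base   : ∀ {k k'} → R k k' → Apply σ R k k'
    target : ∀ {l} → l ∈range σ → Apply σ R l l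
    link   : ∀ {k l} → k ∈dom σ → l ∈range σ → Apply σ R k l
    symm   : ∀ {k k'} → Apply σ R k k' → Apply σ R k' k
    transi : ∀ {k k' k''} → Apply σ R k k' → Apply σ R k' k'' → Apply σ R k k''

  _∪｛_｝ : Rel TrN 0ℓ → TrN → Rel TrN 0ℓ
  (R ∪｛ k ｝) k₁ k₂ = R k₁ k₂ ⊎ (k₁ ≡ k × k₂ ≡ k)

  Extends : History → ExTrN × Status → History → Set
  Extends G e G' = ∃ λ i → G i ≡ nothing × G' i ≡ just e × (∀ j → j ≢ i → G' j ≡ G j)

  data Resolved (R : Rel TrN 0ℓ) (s : Status) (k : TrN) :
                Maybe (ExTrN × Status) → Maybe (ExTrN × Status) → Set where
    change : ∀ {k' a} → R (ext k') k → Resolved R s k (just (k' , act a)) (just (k' , s))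
    keep   : ∀ {e} → (∀ k' a → e ≡ just (k' , act a) → ¬ R (ext k') k) →
             Resolved R s k e e

  -- The environment of C' is Δ∖co k for s = co and Δ∖ab k for s = ab.
  Resolves : Config → Status → TrN → Config → Set
  Resolves C s k C' = (E C' ⇔ᴿ E C) × (∀ i → Resolved (E C) s k (H C i) (H C' i))

  Eₑₓₜ : Config → TrN → Pred ExTrN 0ℓ
  Eₑₓₜ C k k' = E C k (ext k')

  data Event : Set₁ where
    τ     : Event
    _⟨_⟩  : ExTrN → Act → Event
    co    : Pred ExTrN 0ℓ → Event

  -- Both ends are configurations, so the target of a transition is in
  -- particular a process; E and H are compared extensionally, as sets.
  infix 3 _—[_]→c_
  data _—[_]→c_ (C : Config) : Event → Config → Set₁ where
    τ-plain : ∀ {C'} →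
      P C —[ plain τ ∣ ε ]→ P C' →
      E C' ⇔ᴿ E C → H C' ≗ H C →
      C —[ τ ]→c C'

    τ-tr : ∀ {C' k σ} →
      P C —[ int k ⟨ τ ⟩ ∣ σ ]→ P C' → int k ♯Δ C →
      E C' ⇔ᴿ Apply σ (E C) → H C' ≗ H C →
      C —[ τ ]→c C'

    τ-new : ∀ {C' k} →
      P C —⟦ new (int k) ⟧→ P C' → int k ♯Δ C →
      E C' ⇔ᴿ E C → H C' ≗ H C →
      C —[ τ ]→c C'

    co-ext : ∀ {C' k K} →
      P C —⟦ co k ⟧→ P C' → K ≐ Eₑₓₜ C k → ∃ (Eₑₓₜ C k) →
      Resolves C co k C' →
      C —[ co K ]→c C'

    co-int : ∀ {C' k} →
      P C —⟦ co k ⟧→ P C' → (∀ k' → ¬ Eₑₓₜ C k k') →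
      Resolves C co k C' →
      C —[ τ ]→c C'

    τ-ab : ∀ {C' k} →
      P C —⟦ ab k ⟧→ P C' →
      Resolves C ab k C' →
      C —[ τ ]→c C'

    visible : ∀ {C' k a σ} →
      P C —[ ext k ⟨ act (free a) ⟩ ∣ σ ]→ P C' → ext k ♯Δ C →
      E C' ⇔ᴿ Apply σ (E C) → Extends (H C) (k , act a) (H C') →
      C —[ k ⟨ a ⟩ ]→c C'

    idle : ∀ {C' k a} →
      P C' ≡ P C → ext k ♯Δ C →
      E C' ⇔ᴿ (E C ∪｛ ext k ｝) → Extends (H C) (k , ab) (H C') →
      C —[ k ⟨ a ⟩ ]→c C'

  infix 3 _⇒τ_ _=[_]⇒c_
  _⇒τ_ : Config → Config → Set₁
  _⇒τ_ = Star (_—[ τ ]→c_)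

  _=[_]⇒c_ : Config → Event → Config → Set₁
  C =[ τ ]⇒c C' = C ⇒τ C'
  C =[ ζ ]⇒c C' = ∃₂ λ D D' → (C ⇒τ D) × (D —[ ζ ]→c D') × (D' ⇒τ C')

  record Simulates (R : Config → Config → Set₁) : Set₁ where
    field
      on-τ   : ∀ {C₁ C₂ C₁'} → R C₁ C₂ → C₁ =[ τ ]⇒c C₁' →
               ∃ λ C₂' → (C₂ =[ τ ]⇒c C₂') × R C₁' C₂'
      on-act : ∀ {C₁ C₂ C₁' k a} → R C₁ C₂ → C₁ =[ k ⟨ a ⟩ ]⇒c C₁' → ext k ♯ C₂ →
               ∃ λ C₂' → (C₂ =[ k ⟨ a ⟩ ]⇒c C₂') × R C₁' C₂'
      on-co  : ∀ {C₁ C₂ C₁' K} → R C₁ C₂ → C₁ =[ co K ]⇒c C₁' →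
               ∃ λ C₂' → (C₂ =[ co K ]⇒c C₂') × R C₁' C₂'

  IsBisimulation : (Config → Config → Set₁) → Set₁
  IsBisimulation R = Simulates R × Simulates (λ C₂ C₁ → R C₁ C₂)

  infix 4 _≈Canco_
  _≈Canco_ : Config → Config → Set₂
  C₁ ≈Canco C₂ = ∃ λ R → IsBisimulation R × R C₁ C₂

  -- Variables are de Bruijn indices; `Formula n` has n free variables and
  -- `⟨x a ⟩ φ` binds variable 0 of φ.  The index sets of conjunctions
  -- range over the universe containing `Config`.
  data Formula (n : ℕ) : Set₂ where
    ⟨τ⟩_   : Formula n → Formula n
    ⟨x_⟩_  : Act → Formula (suc n) → Formula n
    ¬'_    : Formula n → Formula n
    ⋀      : {M : Set₁} → (M → Formula n) → Formula n
    ⟨co_≢∅_⟩_ : (K : Pred (ExTrN ⊎ Fin n) 0ℓ) → ∃ K → Formula n → Formula n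

  Env : ℕ → Set
  Env n = Fin n → ExTrN

  ∅ : Env 0
  ∅ ()

  _▸_ : ∀ {n} → Env n → ExTrN → Env (suc n)
  (ρ ▸ l) zero    = l
  (ρ ▸ l) (suc x) = ρ x

  instantiate : ∀ {n} → Env n → Pred (ExTrN ⊎ Fin n) 0ℓ → Pred ExTrN 0ℓ
  instantiate ρ K k = ∃ λ z → K z × [ id , ρ ]′ z ≡ k

  -- `ρ ⊢ C ⊨ φ` is satisfaction of the closed formula φ[ρ]; delaying the
  -- substitution makes the definition structurally recursive.  The
  -- substitution clause for ⟨x(a)⟩ is `⊨-⟨x⟩` below.
  infix 4 _⊢_⊨_ _⊨_
  _⊢_⊨_ : ∀ {n} → Env n → Config → Formula n → Set₁
  ρ ⊢ C ⊨ ⟨τ⟩ φ         = ∃ λ C' → (C =[ τ ]⇒c C') × (ρ ⊢ C' ⊨ φ)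
  ρ ⊢ C ⊨ ⟨x a ⟩ φ      =
    ∃ λ (N : Pred ExTrN 0ℓ) → Cofinite N × (∀ l → N l →
      ∃ λ C' → (C =[ l ⟨ a ⟩ ]⇒c C') × (ρ ▸ l ⊢ C' ⊨ φ))
  ρ ⊢ C ⊨ ¬' φ          = ¬ (ρ ⊢ C ⊨ φ)
  ρ ⊢ C ⊨ ⋀ φ           = ∀ i → ρ ⊢ C ⊨ φ i
  ρ ⊢ C ⊨ ⟨co K ≢∅ _ ⟩ φ =
    ∃ λ C' → (C =[ co (instantiate ρ K) ]⇒c C') × (ρ ⊢ C' ⊨ φ)

  _⊨_ : Config → Formula 0 → Set₁
  C ⊨ φ = ∅ ⊢ C ⊨ φ

  -- θ sends each free variable to a name or to a variable.
  Subst : ℕ → ℕ → Set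
  Subst n m = Fin n → ExTrN ⊎ Fin m

  lift-θ : ∀ {n m} → Subst n m → Subst (suc n) (suc m)
  lift-θ θ zero    = inj₂ zero
  lift-θ θ (suc x) = Sum.map id suc (θ x)

  substSet : ∀ {n m} → Subst n m → Pred (ExTrN ⊎ Fin n) 0ℓ → Pred (ExTrN ⊎ Fin m) 0ℓ
  substSet θ K w = ∃ λ z → K z × [ inj₁ , θ ]′ z ≡ w

  substF : ∀ {n m} → Subst n m → Formula n → Formula m
  substF θ (⟨τ⟩ φ)      = ⟨τ⟩ substF θ φ
  substF θ (⟨x a ⟩ φ)   = ⟨x a ⟩ substF (lift-θ θ) φ
  substF θ (¬' φ)       = ¬' substF θ φ
  substF θ (⋀ φ)        = ⋀ (λ i → substF θ (φ i))
  substF θ (⟨co K ≢∅ (z , z∈K) ⟩ φ) =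
    ⟨co substSet θ K ≢∅ ([ inj₁ , θ ]′ z , z , z∈K , refl) ⟩ substF θ φ

  _[_/x] : Formula 1 → ExTrN → Formula 0
  φ [ l /x] = substF (λ _ → inj₁ l) φ

  private
    ≐-sym : {A : Set} {K L : Pred A 0ℓ} → K ≐ L → L ≐ K
    ≐-sym = Product.swap

    co-resp : ∀ {C C' K L} → K ≐ L → C =[ co K ]⇒c C' → C =[ co L ]⇒c C'
    co-resp (p , q) (D , D' , pre , co-ext step (r , s) ne rs , post) =
      D , D' , pre , co-ext step ((λ x → r (q x)) , (λ x → p (s x))) ne rs , post

    instantiate-subst : ∀ {n m} (θ : Subst n m) (ρ : Env m) (ρ' : Env n) →
      (∀ x → [ id , ρ ]′ (θ x) ≡ ρ' x) → ∀ K →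
      instantiate ρ (substSet θ K) ≐ instantiate ρ' K
    instantiate-subst θ ρ ρ' h K =
      (λ { (_ , (inj₁ k , z∈K , refl) , e) → inj₁ k , z∈K , e
         ; (_ , (inj₂ x , z∈K , refl) , e) → inj₂ x , z∈K , trans (sym (h x)) e }) ,
      (λ { (inj₁ k , z∈K , e) → inj₁ k , (inj₁ k , z∈K , refl) , e
         ; (inj₂ x , z∈K , e) → θ x , (inj₂ x , z∈K , refl) , trans (h x) e })

    lift-env : ∀ {n m} (θ : Subst n m) (ρ : Env m) (ρ' : Env n) l →
      (∀ x → [ id , ρ ]′ (θ x) ≡ ρ' x) →
      ∀ x → [ id , ρ ▸ l ]′ (lift-θ θ x) ≡ (ρ' ▸ l) x
    lift-env θ ρ ρ' l h zero = refl
    lift-env θ ρ ρ' l h (suc x) with θ x | h x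
    ... | inj₁ _ | e = e
    ... | inj₂ _ | e = e

    mutual
      ⊨-subst⇒ : ∀ {n m} (θ : Subst n m) (ρ : Env m) (ρ' : Env n) →
        (∀ x → [ id , ρ ]′ (θ x) ≡ ρ' x) →
        ∀ (φ : Formula n) {C} → ρ ⊢ C ⊨ substF θ φ → ρ' ⊢ C ⊨ φ
      ⊨-subst⇒ θ ρ ρ' h (⟨τ⟩ φ) (C' , w , s) = C' , w , ⊨-subst⇒ θ ρ ρ' h φ s
      ⊨-subst⇒ θ ρ ρ' h (⟨x a ⟩ φ) (N , cof , f) = N , cof , λ l l∈N →
        let (C' , w , s) = f l l∈N
        in C' , w , ⊨-subst⇒ (lift-θ θ) (ρ ▸ l) (ρ' ▸ l) (lift-env θ ρ ρ' l h) φ s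
      ⊨-subst⇒ θ ρ ρ' h (¬' φ) s = λ t → s (⊨-subst⇐ θ ρ ρ' h φ t)
      ⊨-subst⇒ θ ρ ρ' h (⋀ φ) s = λ i → ⊨-subst⇒ θ ρ ρ' h (φ i) (s i)
      ⊨-subst⇒ θ ρ ρ' h (⟨co K ≢∅ _ ⟩ φ) (C' , w , s) =
        C' , co-resp (instantiate-subst θ ρ ρ' h K) w , ⊨-subst⇒ θ ρ ρ' h φ s

      ⊨-subst⇐ : ∀ {n m} (θ : Subst n m) (ρ : Env m) (ρ' : Env n) →
        (∀ x → [ id , ρ ]′ (θ x) ≡ ρ' x) →
        ∀ (φ : Formula n) {C} → ρ' ⊢ C ⊨ φ → ρ ⊢ C ⊨ substF θ φ
      ⊨-subst⇐ θ ρ ρ' h (⟨τ⟩ φ) (C' , w , s) = C' , w , ⊨-subst⇐ θ ρ ρ' h φ s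
      ⊨-subst⇐ θ ρ ρ' h (⟨x a ⟩ φ) (N , cof , f) = N , cof , λ l l∈N →
        let (C' , w , s) = f l l∈N
        in C' , w , ⊨-subst⇐ (lift-θ θ) (ρ ▸ l) (ρ' ▸ l) (lift-env θ ρ ρ' l h) φ s
      ⊨-subst⇐ θ ρ ρ' h (¬' φ) s = λ t → s (⊨-subst⇒ θ ρ ρ' h φ t)
      ⊨-subst⇐ θ ρ ρ' h (⋀ φ) s = λ i → ⊨-subst⇐ θ ρ ρ' h (φ i) (s i)
      ⊨-subst⇐ θ ρ ρ' h (⟨co K ≢∅ (z , z∈K) ⟩ φ) (C' , w , s) =
        C' , co-resp (≐-sym (instantiate-subst θ ρ ρ' h K)) w , ⊨-subst⇐ θ ρ ρ' h φ s

  ⊨-⟨x⟩ : ∀ C a (φ : Formula 1) →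
    (C ⊨ ⟨x a ⟩ φ) ⇔
    (∃ λ (N : Pred ExTrN 0ℓ) → Cofinite N × (∀ l → N l →
      ∃ λ C' → (C =[ l ⟨ a ⟩ ]⇒c C') × (C' ⊨ φ [ l /x])))
  ⊨-⟨x⟩ C a φ = mk⇔
    (λ (N , cof , f) → N , cof , λ l l∈N → let (C' , w , s) = f l l∈N in
       C' , w , ⊨-subst⇐ (λ _ → inj₁ l) ∅ (∅ ▸ l) (λ { zero → refl }) φ s)
    (λ (N , cof , f) → N , cof , λ l l∈N → let (C' , w , s) = f l l∈N in
       C' , w , ⊨-subst⇒ (λ _ → inj₁ l) ∅ (∅ ▸ l) (λ { zero → refl }) φ s)

  𝓛Canco : Config → Pred (Formula 0) _
  𝓛Canco C φ = C ⊨ φ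

{-# OPTIONS --safe #-}
-- Soundness is an induction on formulas; for ⟨x(a)⟩ the cofinite set is
-- shrunk to the names fresh for the other configuration.
--
-- For completeness, logical equivalence is not used directly: infinitary
-- formulas may mention every name, so a name k introduced by a visible step
-- could not be abstracted from them.  Instead two configurations agree when
-- they satisfy the same formulas over a fixed finite set A of constants, in an
-- environment ρ, where A and ρ together name exactly the external names of the
-- two configurations.  Classically each configuration has a characteristic
-- formula for this notion, the conjunction of one separating formula per
-- inequivalent configuration, so a τ- or commit step is matched by prefixing
-- the characteristic formula of its target with a modality.  A visible step
-- with a fresh name k extends ρ by k.  Swapping k with another fresh name l
-- leaves the source unchanged, so all fresh names satisfy the formula, which
-- gives ⟨x(a)⟩; conversely, the match found for some fresh l is swapped back
-- to k.
module Submission where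

open import Defs
open import Level using (0ℓ; suc; Lift)
open import Axiom.ExcludedMiddle using (ExcludedMiddle)
open import Function.Bundles using (_⇔_)
open import Relation.Unary using (_≐_)

import Level
open import Axiom.DoubleNegationElimination using (em⇒dne)
open import Data.Empty using (⊥; ⊥-elim)
open import Data.Fin using (Fin)
open import Data.List using (List; []; _∷_; _++_; map)
open import Data.List.Membership.Propositional using (_∈_)
open import Data.List.Membership.Propositional.Properties
  using (∈-map⁺; ∈-map⁻; ∈-++⁺ˡ; ∈-++⁺ʳ)
import Data.List.Membership.DecPropositional as DecMembership
open import Data.List.Properties using (map-++; map-∘; map-id; map-cong)
open import Data.List.Relation.Unary.Any using (here; there)
open import Data.Maybe using (Maybe; just; nothing)
import Data.Maybe as Maybe
open import Data.Maybe.Properties using (just-injective)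
open import Data.Nat using (ℕ)
import Data.Nat as ℕ
open import Data.Product using (∃; _×_; _,_; proj₁; proj₂)
import Data.Product as Product
open import Data.Sum using (_⊎_; inj₁; inj₂; [_,_]′)
import Data.Sum as Sum
open import Function using (_∘_; id; case_of_)
open import Function.Bundles using (Equivalence; mk⇔; _↣_)
open import Function.Construct.Identity using (↔-id)
open import Relation.Binary.Construct.Closure.ReflexiveTransitive
  using (_◅_) renaming (ε to done)
open import Relation.Binary.Core using (Rel) renaming (_⇔_ to _⇔ᴿ_)
open import Relation.Binary.Definitions using (DecidableEquality)
open import Relation.Binary.PropositionalEquality
  using (_≡_; _≢_; _≗_; refl; sym; trans; cong; cong₂)
  renaming (subst to transport; subst₂ to transport₂)
open import Relation.Binary.Structures using (IsPartialEquivalence)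
open import Relation.Nullary using (¬_; Dec; yes; no; contradiction)
open import Relation.Nullary.Decidable using (True; toWitness; fromWitness; map′; via-injection)
open import Relation.Unary using (Pred)

-- Transpositions on a set with decidable equality.

module Transposition {A : Set} (_≟_ : DecidableEquality A) (k l : A) where

  swap : A → A
  swap x with x ≟ k | x ≟ l
  ... | yes _ | _     = l
  ... | no _  | yes _ = k
  ... | no _  | no _  = x

  swap-left : swap k ≡ l
  swap-left with k ≟ k
  ... | yes _ = refl
  ... | no ≢  = contradiction refl ≢

  swap-right : swap l ≡ k
  swap-right with l ≟ k | l ≟ l
  ... | yes l≡k | _     = l≡k
  ... | no _    | yes _ = refl
  ... | no _    | no ≢  = contradiction refl ≢

  swap-other : ∀ {x} → x ≢ k → x ≢ l → swap x ≡ x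
  swap-other {x} ≢k ≢l with x ≟ k | x ≟ l
  ... | yes ≡k | _      = contradiction ≡k ≢k
  ... | no _   | yes ≡l = contradiction ≡l ≢l
  ... | no _   | no _   = refl

  swap-involutive : ∀ x → swap (swap x) ≡ x
  swap-involutive x with x ≟ k | x ≟ l
  ... | yes refl | _        = swap-right
  ... | no _     | yes refl = swap-left
  ... | no ≢k    | no ≢l    = swap-other ≢k ≢l

module _ (S : Signature) where
  open Signature S
  open Calculus S
  open Config
  open DecMembership _≟_ using (_∈?_)
  open Equivalence

  -- Commit labels are predicates, so equal sets need not be equal labels. The rule `co-ext` fixes
  -- its label only up to `≐`, which allows the step to be relabelled.
  co-respects-≐ : ∀ {C C' K L} → K ≐ L → C =[ co K ]⇒c C' → C =[ co L ]⇒c C'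
  co-respects-≐ (f , g) (D , D' , pre , co-ext u (f' , g') ne r , post) =
    D , D' , pre , co-ext u ((λ x → f' (g x)) , (λ x → f (g' x))) ne r , post

  -- Constants occur only in the sets of commit modalities, so the other connectives impose no
  -- condition; variables in `K` are unrestricted. An involution fixing `A` pointwise then leaves
  -- such a formula unchanged.
  Over : Pred ExTrN 0ℓ → ∀ {n} → Formula n → Set₁
  Over A (⟨τ⟩ φ)           = Over A φ
  Over A (⟨x a ⟩ φ)        = Over A φ
  Over A (¬' φ)            = Over A φ
  Over A (⋀ φ)             = ∀ i → Over A (φ i)
  Over A (⟨co K ≢∅ _ ⟩ φ)  = (∀ k → K (inj₁ k) → A k) × Over A φ

  -- Invariance under an involution of the external names

  module Renaming (p : ExTrN → ExTrN) (p-involutive : ∀ k → p (p k) ≡ k) where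

    -- Internal names can stay fixed, since neither formulas nor visible events mention them.
    π : TrN → TrN
    π = Sum.map id p

    π-involutive : ∀ k → π (π k) ≡ k
    π-involutive (int k) = refl
    π-involutive (ext k) = cong ext (p-involutive k)

    π-injective : ∀ {k l} → π k ≡ π l → k ≡ l
    π-injective {k} {l} e =
      trans (sym (π-involutive k)) (trans (cong π e) (π-involutive l))

    -- A relation rather than a function: renaming under a sum commutes with
    -- the operations on terms only up to pointwise equality of summands.
    infix 4 _∼_
    data _∼_ {m n : ℕ} : Term m n → Term m n → Set₁ where
      ∑∼   : ∀ {J} {c : J ↣ ℕ} {μ μ' P P'} → μ ≗ μ' → (∀ j → P j ∼ P' j) →
             ∑ c μ P ∼ ∑ c μ' P'
      ∣∼   : ∀ {P P' Q Q'} → P ∼ P' → Q ∼ Q' → P ∣ Q ∼ P' ∣ Q'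
      ν∼   : ∀ {P P'} → P ∼ P' → ν P ∼ ν P'
      var∼ : ∀ {x} → var x ∼ var x
      rec∼ : ∀ {P P'} → P ∼ P' → rec P ∼ rec P'
      ▷∼   : ∀ {P P' k k' Q Q'} → P ∼ P' → k' ≡ π k → Q ∼ Q' →
             ⟦ P ▷[ k ] Q ⟧ ∼ ⟦ P' ▷[ k' ] Q' ⟧
      co∼  : co ∼ co
      ▶∼   : ∀ {P P' Q Q'} → P ∼ P' → Q ∼ Q' → ⟦ P ▶ Q ⟧ ∼ ⟦ P' ▶ Q' ⟧

    -- As `π` is its own inverse, every one-directional property of `_∼_` can also be used
    -- backwards.
    ∼-sym : ∀ {m n} {P Q : Term m n} → P ∼ Q → Q ∼ P
    ∼-sym (∑∼ e s)    = ∑∼ (sym ∘ e) (∼-sym ∘ s)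
    ∼-sym (∣∼ s t)    = ∣∼ (∼-sym s) (∼-sym t)
    ∼-sym (ν∼ s)      = ν∼ (∼-sym s)
    ∼-sym var∼        = var∼
    ∼-sym (rec∼ s)    = rec∼ (∼-sym s)
    ∼-sym (▷∼ s refl t) = ▷∼ (∼-sym s) (sym (π-involutive _)) (∼-sym t)
    ∼-sym co∼         = co∼
    ∼-sym (▶∼ s t)    = ▶∼ (∼-sym s) (∼-sym t)

    ∼-fixed : ∀ {m n} (P : Term m n) → (∀ k → k ∈ftn P → π k ≡ k) → P ∼ P
    ∼-fixed (∑ c μ P) h      = ∑∼ (λ _ → refl) (λ j → ∼-fixed (P j) (λ k → h k ∘ (j ,_)))
    ∼-fixed (P ∣ Q) h        = ∣∼ (∼-fixed P (λ k → h k ∘ inj₁)) (∼-fixed Q (λ k → h k ∘ inj₂))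
    ∼-fixed (ν P) h          = ν∼ (∼-fixed P h)
    ∼-fixed (var x) h        = var∼
    ∼-fixed (rec P) h        = rec∼ (∼-fixed P h)
    ∼-fixed ⟦ P ▷[ k ] Q ⟧ h = ▷∼ (∼-fixed P (λ k → h k ∘ inj₂ ∘ inj₁)) (sym (h k (inj₁ refl)))
                                  (∼-fixed Q (λ k → h k ∘ inj₂ ∘ inj₂))
    ∼-fixed co h             = co∼
    ∼-fixed ⟦ P ▶ Q ⟧ h      = ▶∼ (∼-fixed P (λ k → h k ∘ inj₁)) (∼-fixed Q (λ k → h k ∘ inj₂))

    ∼-ren : ∀ {m m' n n'} {r : Fin m → Fin m'} {s : Fin n → Fin n'} {P Q} →
            P ∼ Q → ren r s P ∼ ren r s Q
    ∼-ren (∑∼ e s)      = ∑∼ (cong (renPrefix _) ∘ e) (λ j → ∼-ren (s j))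
    ∼-ren (∣∼ s t)      = ∣∼ (∼-ren s) (∼-ren t)
    ∼-ren (ν∼ s)        = ν∼ (∼-ren s)
    ∼-ren var∼          = var∼
    ∼-ren (rec∼ s)      = rec∼ (∼-ren s)
    ∼-ren (▷∼ s e t)    = ▷∼ (∼-ren s) e (∼-ren t)
    ∼-ren co∼           = co∼
    ∼-ren (▶∼ s t)      = ▶∼ (∼-ren s) (∼-ren t)

    ∼-subst : ∀ {m n n'} {θ θ' : Fin n → Term m n'} {P Q} →
              (∀ x → θ x ∼ θ' x) → P ∼ Q → subst θ P ∼ subst θ' Q
    ∼-subst h (∑∼ e s)   = ∑∼ e (λ j → ∼-subst h (s j))
    ∼-subst h (∣∼ s t)   = ∣∼ (∼-subst h s) (∼-subst h t)
    ∼-subst h (ν∼ s)     = ν∼ (∼-subst (∼-ren ∘ h) s)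
    ∼-subst h (var∼ {x}) = h x
    ∼-subst h (rec∼ s)   =
      rec∼ (∼-subst (λ { Fin.zero → var∼ ; (Fin.suc x) → ∼-ren (h x) }) s)
    ∼-subst h (▷∼ s e t) = ▷∼ (∼-subst h s) e (∼-subst h t)
    ∼-subst h co∼        = co∼
    ∼-subst h (▶∼ s t)   = ▶∼ (∼-subst h s) (∼-subst h t)

    -- Name substitutions and free transaction names under renaming.

    πˢ : NameSubst → NameSubst
    πˢ ε        = ε
    πˢ (ks ↦ l) = map π ks ↦ π l

    πˢ-involutive : ∀ σ → πˢ (πˢ σ) ≡ σ
    πˢ-involutive ε        = refl
    πˢ-involutive (ks ↦ l) = cong₂ _↦_
      (trans (sym (map-∘ ks)) (trans (map-cong π-involutive ks) (map-id ks)))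
      (π-involutive l)

    π-∈⁻ : ∀ {k ks} → π k ∈ map π ks → k ∈ ks
    π-∈⁻ πk∈ with ∈-map⁻ π πk∈
    ... | l , l∈ , e = transport (_∈ _) (sym (π-injective e)) l∈

    ∈dom-π : ∀ {k} σ → k ∈dom σ → π k ∈dom πˢ σ
    ∈dom-π (ks ↦ l) = ∈-map⁺ π

    ∈range-π : ∀ {k} σ → k ∈range σ → π k ∈range πˢ σ
    ∈range-π (ks ↦ l) = cong π

    -- Injectivity of `π` makes `k ∈ ks` and `π k ∈ map π ks` equivalent, so the two mixed cases are
    -- contradictory.
    applyName-π : ∀ σ k → applyName (πˢ σ) (π k) ≡ π (applyName σ k)
    applyName-π ε        k = refl
    applyName-π (ks ↦ l) k with k ∈? ks | π k ∈? map π ks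
    ... | yes _   | yes _   = refl
    ... | yes k∈  | no  πk∉ = contradiction (∈-map⁺ π k∈) πk∉
    ... | no  k∉  | yes πk∈ = contradiction (π-∈⁻ πk∈) k∉
    ... | no  _   | no  _   = refl

    ∼-⟪⟫ : ∀ {m n} {P Q : Term m n} σ → P ∼ Q → P ⟪ σ ⟫ ∼ Q ⟪ πˢ σ ⟫
    ∼-⟪⟫ σ (∑∼ e s)   = ∑∼ e (∼-⟪⟫ σ ∘ s)
    ∼-⟪⟫ σ (∣∼ s t)   = ∣∼ (∼-⟪⟫ σ s) (∼-⟪⟫ σ t)
    ∼-⟪⟫ σ (ν∼ s)     = ν∼ (∼-⟪⟫ σ s)
    ∼-⟪⟫ σ var∼       = var∼
    ∼-⟪⟫ σ (rec∼ s)   = rec∼ (∼-⟪⟫ σ s)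
    ∼-⟪⟫ σ (▷∼ {k = k} s refl t) = ▷∼ (∼-⟪⟫ σ s) (applyName-π σ k) (∼-⟪⟫ σ t)
    ∼-⟪⟫ σ co∼        = co∼
    ∼-⟪⟫ σ (▶∼ s t)   = ▶∼ (∼-⟪⟫ σ s) (∼-⟪⟫ σ t)

    ∼-ftn : ∀ {m n} {P Q : Term m n} {k} → P ∼ Q → k ∈ftn P → π k ∈ftn Q
    ∼-ftn (∑∼ e s) (j , k∈)          = j , ∼-ftn (s j) k∈
    ∼-ftn (∣∼ s t) (inj₁ k∈)         = inj₁ (∼-ftn s k∈)
    ∼-ftn (∣∼ s t) (inj₂ k∈)         = inj₂ (∼-ftn t k∈)
    ∼-ftn (ν∼ s) k∈                  = ∼-ftn s k∈
    ∼-ftn (rec∼ s) k∈                = ∼-ftn s k∈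
    ∼-ftn (▷∼ s refl t) (inj₁ refl)  = inj₁ refl
    ∼-ftn (▷∼ s e t) (inj₂ (inj₁ k∈)) = inj₂ (inj₁ (∼-ftn s k∈))
    ∼-ftn (▷∼ s e t) (inj₂ (inj₂ k∈)) = inj₂ (inj₂ (∼-ftn t k∈))
    ∼-ftn (▶∼ s t) (inj₁ k∈)         = inj₁ (∼-ftn s k∈)
    ∼-ftn (▶∼ s t) (inj₂ k∈)         = inj₂ (∼-ftn t k∈)

    ∼-ftn⁻ : ∀ {m n} {P Q : Term m n} {k} → P ∼ Q → k ∈ftn Q → π k ∈ftn P
    ∼-ftn⁻ s = ∼-ftn (∼-sym s)

    ∼-∉ftn : ∀ {m n} {P Q : Term m n} {k} → P ∼ Q → ¬ k ∈ftn P → ¬ π k ∈ftn Q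
    ∼-∉ftn {P = P} {k = k} s k∉ πk∈ =
      k∉ (transport (_∈ftn P) (π-involutive k) (∼-ftn⁻ s πk∈))

    -- Renaming preserves well-formedness.

    ∼-NoTrN : ∀ {m n} {P Q : Term m n} → P ∼ Q → NoTrN P → NoTrN Q
    ∼-NoTrN s none k k∈ = none (π k) (∼-ftn⁻ s k∈)

    ∼-NoDormant : ∀ {m n} {P Q : Term m n} → P ∼ Q → NoDormant P → NoDormant Q
    ∼-NoDormant (∑∼ e s) d         = λ j → ∼-NoDormant (s j) (d j)
    ∼-NoDormant (∣∼ s t) (d , d')  = ∼-NoDormant s d , ∼-NoDormant t d'
    ∼-NoDormant (ν∼ s) d           = ∼-NoDormant s d
    ∼-NoDormant var∼ d             = d
    ∼-NoDormant (rec∼ s) d         = ∼-NoDormant s d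
    ∼-NoDormant (▷∼ s _ t) (d , d') = ∼-NoDormant s d , ∼-NoDormant t d'
    ∼-NoDormant co∼ d              = d

    ∼-fpv : ∀ {m n} {P Q : Term m n} {x} → P ∼ Q → x ∈fpv P → x ∈fpv Q
    ∼-fpv (∑∼ e s) (j , x∈)    = j , ∼-fpv (s j) x∈
    ∼-fpv (∣∼ s t) x∈          = Sum.map (∼-fpv s) (∼-fpv t) x∈
    ∼-fpv (ν∼ s) x∈            = ∼-fpv s x∈
    ∼-fpv var∼ x∈              = x∈
    ∼-fpv (rec∼ s) x∈          = ∼-fpv s x∈
    ∼-fpv (▷∼ s _ t) x∈        = Sum.map (∼-fpv s) (∼-fpv t) x∈
    ∼-fpv (▶∼ s t) x∈          = Sum.map (∼-fpv s) (∼-fpv t) x∈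

    ∼-Closed : ∀ {m n} {P Q : Term m n} → P ∼ Q → Closed P → Closed Q
    ∼-Closed s closed x x∈ = closed x (∼-fpv (∼-sym s) x∈)

    ∼-Subterms-ok : ∀ {m n} {P Q : Term m n} → P ∼ Q → Subterms-ok P → Subterms-ok Q
    ∼-Subterms-ok (∑∼ e s) ok j = let (a , b , c) = ok j in
      ∼-NoTrN (s j) a , ∼-NoDormant (s j) b , ∼-Subterms-ok (s j) c
    ∼-Subterms-ok (∣∼ s t) (a , b) = ∼-Subterms-ok s a , ∼-Subterms-ok t b
    ∼-Subterms-ok (ν∼ s) a         = ∼-Subterms-ok s a
    ∼-Subterms-ok var∼ a           = a
    ∼-Subterms-ok (rec∼ s) (a , b) = ∼-NoTrN s a , ∼-Subterms-ok s b
    ∼-Subterms-ok (▷∼ s _ t) (a , b , c , d , e , f) =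
      ∼-NoTrN s a , ∼-NoTrN t b , ∼-NoDormant s c , ∼-Closed s d ,
      ∼-Subterms-ok s e , ∼-Subterms-ok t f
    ∼-Subterms-ok co∼ a            = a
    ∼-Subterms-ok (▶∼ s t) (a , b , c , d , e , f) =
      ∼-NoTrN s a , ∼-NoTrN t b , ∼-NoDormant s c , ∼-Closed s d ,
      ∼-Subterms-ok s e , ∼-Subterms-ok t f

    Finite-π : ∀ {N N' : Pred TrN 0ℓ} → (∀ k → N' k → N (π k)) → Finite N → Finite N'
    Finite-π h (ks , all) = map π ks , λ k k∈ →
      transport (_∈ map π ks) (π-involutive k) (∈-map⁺ π (all (π k) (h k k∈)))

    ∼-IsProcess : ∀ {P Q} → P ∼ Q → IsProcess P → IsProcess Q
    ∼-IsProcess s (closed , fin , ok) =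
      ∼-Closed s closed , Finite-π (λ _ → ∼-ftn⁻ s) fin , ∼-Subterms-ok s ok

    -- Only running transactions carry names, so in a name-free term the two sides differ at most by
    -- pointwise equality of prefixes, which `∑-cong` absorbs. This serves the `_≋_` premise of
    -- `commit` without a proof that structural equivalence is invariant under renaming.
    ∼⇒≋ : ∀ {m n} {P Q : Term m n} → P ∼ Q → NoTrN P → P ≋ Q
    ∼⇒≋ (∑∼ e s) none  = ∑-cong (↔-id _) e (λ j → ∼⇒≋ (s j) (λ k → none k ∘ (j ,_)))
    ∼⇒≋ (∣∼ s t) none  = ∣-cong (∼⇒≋ s (λ k → none k ∘ inj₁)) (∼⇒≋ t (λ k → none k ∘ inj₂))
    ∼⇒≋ (ν∼ s) none    = ν-cong (∼⇒≋ s none)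
    ∼⇒≋ var∼ none      = ≋-refl
    ∼⇒≋ (rec∼ s) none  = rec-cong (∼⇒≋ s none)
    ∼⇒≋ (▷∼ s e t) none = ⊥-elim (none _ (inj₁ refl))
    ∼⇒≋ co∼ none       = ≋-refl
    ∼⇒≋ (▶∼ s t) none  = ▶-cong (∼⇒≋ s (λ k → none k ∘ inj₁)) (∼⇒≋ t (λ k → none k ∘ inj₂))

    -- Process and reconfiguration transitions under renaming.

    πˡ : ∀ {m} → Label m → Label m
    πˡ (plain μ) = plain μ
    πˡ (k ⟨ μ ⟩) = π k ⟨ μ ⟩

    πˡ-weaken : ∀ {m} (α : Label m) → πˡ (weakenLabel α) ≡ weakenLabel (πˡ α)
    πˡ-weaken (plain μ) = refl
    πˡ-weaken (k ⟨ μ ⟩) = refl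

    ∼-range : ∀ {m n} {P Q : Term m n} σ → P ∼ Q →
              (∀ k → k ∈range σ → ¬ k ∈ftn P) → ∀ k → k ∈range πˢ σ → ¬ k ∈ftn Q
    ∼-range (ks ↦ l) s fresh _ refl = ∼-∉ftn s (fresh l refl)

    -- The distinctness and freshness side conditions of the rules carry over because `π` is a
    -- bijection.
    ∼-step : ∀ {m} {P Q P' : Term m 0} {α σ} → P ∼ Q → P —[ α ∣ σ ]→ P' →
             ∃ λ Q' → (Q —[ πˡ α ∣ πˢ σ ]→ Q') × P' ∼ Q'
    ∼-step (∑∼ e s) (sum j) rewrite e j = _ , sum j , s j
    ∼-step (∣∼ s t) (sync u v) =
      let (_ , u' , s') = ∼-step s u ; (_ , v' , t') = ∼-step t v
      in _ , sync u' v' , ∣∼ s' t'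
    ∼-step (rec∼ s) unfold =
      _ , unfold , ∼-subst (λ { Fin.zero → rec∼ s ; (Fin.suc x) → var∼ }) s
    ∼-step (∑∼ e s) (tr-sum j μj≡) =
      _ , tr-sum j (trans (sym (e j)) μj≡) , ▷∼ (∣∼ (s j) co∼) refl (∑∼ e s)
    ∼-step (▷∼ s refl t) (tr-run u k≢l) =
      let (_ , u' , s') = ∼-step s u
      in _ , tr-run u' (k≢l ∘ π-injective) , ▷∼ s' refl t
    ∼-step (∣∼ s t) (tr-sync {k = k} {ls₁} {ls₂} u v) rewrite map-++ π ls₁ ls₂ =
      let (_ , u' , s') = ∼-step s u ; (_ , v' , t') = ∼-step t v
      in _ , tr-sync u' v' , ∣∼ (∼-⟪⟫ (ls₂ ↦ k) s') (∼-⟪⟫ (ls₁ ↦ k) t')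
    ∼-step {σ = σ} (∣∼ s t) (parˡ u fresh) =
      let (_ , u' , s') = ∼-step s u
      in _ , parˡ u' (∼-range σ t fresh) , ∣∼ s' (∼-⟪⟫ σ t)
    ∼-step {σ = σ} (∣∼ s t) (parʳ v fresh) =
      let (_ , v' , t') = ∼-step t v
      in _ , parʳ v' (∼-range σ s fresh) , ∣∼ (∼-⟪⟫ σ s) t'
    ∼-step {α = α} {σ} (ν∼ {P' = Q} s) (res u) =
      let (Q' , u' , s') = ∼-step s u
      in _ , res (transport (Q —[_∣ πˢ σ ]→ Q') (πˡ-weaken α) u') , ν∼ s'

    ∼-⇝co : ∀ {m n} {P Q P' : Term m n} → P ∼ Q → P ⇝co P' → ∃ λ Q' → Q ⇝co Q' × P' ∼ Q'
    ∼-⇝co co∼ ⇝-co = _ , ⇝-co , ∑∼ (λ ()) (λ ())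
    ∼-⇝co (∑∼ e s) ⇝-sum = _ , ⇝-sum , ∑∼ e s
    ∼-⇝co var∼ ⇝-var = _ , ⇝-var , var∼
    ∼-⇝co (rec∼ s) ⇝-rec = _ , ⇝-rec , rec∼ s
    ∼-⇝co (▶∼ s t) ⇝-dormant = _ , ⇝-dormant , ▶∼ s t
    ∼-⇝co (ν∼ s) (⇝-ν u) = let (_ , u' , s') = ∼-⇝co s u in _ , ⇝-ν u' , ν∼ s'
    ∼-⇝co (∣∼ s t) (⇝-∣ u v) =
      let (_ , u' , s') = ∼-⇝co s u ; (_ , v' , t') = ∼-⇝co t v
      in _ , ⇝-∣ u' v' , ∣∼ s' t'

    πʳ : Reconf → Reconf
    πʳ (co k)  = co (π k)
    πʳ (ab k)  = ab (π k)
    πʳ (new k) = new (π k)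

    nameOf-π : ∀ β → nameOf (πʳ β) ≡ π (nameOf β)
    nameOf-π (co k)  = refl
    nameOf-π (ab k)  = refl
    nameOf-π (new k) = refl

    IsEnd-π : ∀ {β} → IsEnd β → IsEnd (πʳ β)
    IsEnd-π co = co
    IsEnd-π ab = ab

    -- Well-formedness is assumed for the sake of `commit`: the body of a running transaction then
    -- contains no names, and `∼⇒≋` applies to it.
    ∼-reconf : ∀ {m} {P Q P' : Term m 0} {β} → Subterms-ok P → P ∼ Q → P —⟦ β ⟧→ P' →
               ∃ λ Q' → (Q —⟦ πʳ β ⟧→ Q') × P' ∼ Q'
    ∼-reconf (none , _) (▷∼ s refl t) (commit P≋ P⇝) =
      let (_ , Q⇝ , s') = ∼-⇝co s P⇝
      in _ , commit (≋-trans (≋-sym (∼⇒≋ s none)) P≋) Q⇝ , s'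
    ∼-reconf ok (▶∼ s t) start = _ , start , ▷∼ s refl t
    ∼-reconf ok (▷∼ s refl t) abort = _ , abort , t
    ∼-reconf (ok , ok') (∣∼ s t) (both end u v) =
      let (_ , u' , s') = ∼-reconf ok s u ; (_ , v' , t') = ∼-reconf ok' t v
      in _ , both (IsEnd-π end) u' v' , ∣∼ s' t'
    ∼-reconf {β = β} (ok , _) (∣∼ {Q' = Q'} s t) (parˡ u fresh) =
      let (_ , u' , s') = ∼-reconf ok s u
      in _ , parˡ u' (∼-∉ftn t fresh ∘ transport (_∈ftn Q') (nameOf-π β)) , ∣∼ s' t
    ∼-reconf {β = β} (_ , ok) (∣∼ {P' = P'} s t) (parʳ v fresh) =
      let (_ , v' , t') = ∼-reconf ok t v
      in _ , parʳ v' (∼-∉ftn s fresh ∘ transport (_∈ftn P') (nameOf-π β)) , ∣∼ s t'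
    ∼-reconf ok (ν∼ s) (res u) =
      let (_ , u' , s') = ∼-reconf ok s u in _ , res u' , ν∼ s'

    -- Histories and configurations under renaming.

    πʰ : Maybe (ExTrN × Status) → Maybe (ExTrN × Status)
    πʰ = Maybe.map (Product.map₁ p)

    πʰ-involutive : ∀ h → πʰ (πʰ h) ≡ h
    πʰ-involutive nothing        = refl
    πʰ-involutive (just (k , s)) = cong (λ l → just (l , s)) (p-involutive k)

    πʰ-flip : ∀ {h h'} → πʰ h ≡ h' → h ≡ πʰ h'
    πʰ-flip {h} e = trans (sym (πʰ-involutive h)) (cong πʰ e)

    ∈Hᵗʳⁿ-π : ∀ {G G'} → (∀ i → G' i ≡ πʰ (G i)) → ∀ k → k ∈Hᵗʳⁿ G → π k ∈Hᵗʳⁿ G'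
    ∈Hᵗʳⁿ-π h (ext k) (i , s , e) = i , s , trans (h i) (cong πʰ e)

    ∈Hasco-π : ∀ {G G'} → (∀ i → G' i ≡ πʰ (G i)) → ∀ k → k ∈Hasco G → π k ∈Hasco G'
    ∈Hasco-π h (ext k) (i , e) = i , trans (h i) (cong πʰ e)

    infix 4 _≃_
    -- The relation of `D` is given as a pullback along `π`, which for an involution is also the
    -- direct image.
    record _≃_ (C D : Config) : Set₁ where
      field
        E-≃ : ∀ k k' → E D k k' ⇔ E C (π k) (π k')
        H-≃ : ∀ i → H D i ≡ πʰ (H C i)
        P-≃ : P C ∼ P D
    open _≃_

    ≃-sym : ∀ {C D} → C ≃ D → D ≃ C
    ≃-sym {C} {D} r = record
      { E-≃ = λ k k' → mk⇔
          (λ e → from (E-≃ r _ _)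
            (transport₂ (E C) (sym (π-involutive k)) (sym (π-involutive k')) e))
          (λ e → transport₂ (E C) (π-involutive k) (π-involutive k') (to (E-≃ r _ _) e))
      ; H-≃ = λ i → πʰ-flip (sym (H-≃ r i))
      ; P-≃ = ∼-sym (P-≃ r)
      }

    -- The process `Q` is a parameter instead of being computed, because a matching step delivers
    -- its own target, related to `P C` only by `_∼_`.
    image : ∀ C {Q} → P C ∼ Q → Config
    image C {Q} s = record
      { E = λ k k' → E C (π k) (π k')
      ; H = πʰ ∘ H C
      ; P = Q
      ; E-equiv = record { sym = sym-E ; trans = trans-E }
      ; E-finite = Finite-π (λ _ → id) (E-finite C)
      ; H-finite = let (is , all) = H-finite C in is , λ i h → all i (h ∘ cong πʰ)
      ; P-process = ∼-IsProcess s (P-process C)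
      ; H-distinct = λ e e' → H-distinct C (πʰ-flip e) (πʰ-flip e')
      ; E-dom = λ k → mk⇔
          (λ e → back k (to (E-dom C (p k)) e))
          (λ k∈ → from (E-dom C (p k)) (forth (ext k) k∈))
      ; E-hasco = λ {k} {k'} e → mk⇔
          (λ k∈ → back-co k' (to (E-hasco C e) (forth-co (ext k) k∈)))
          (λ k∈ → back-co k (from (E-hasco C e) (forth-co (ext k') k∈)))
      ; P-hasco = λ k k∈ k∈co → P-hasco C (π k) (∼-ftn⁻ s k∈) (forth-co k k∈co)
      ; P-separate = λ e k∈ k'∈ → π-injective (P-separate C e (∼-ftn⁻ s k∈) (∼-ftn⁻ s k'∈))
      ; P-external = λ k k∈ → back k (P-external C (p k) (∼-ftn⁻ s k∈))
      }
      where
      open IsPartialEquivalence (E-equiv C) renaming (sym to sym-E; trans to trans-E)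
      G : History
      G = πʰ ∘ H C
      forth : ∀ k → k ∈Hᵗʳⁿ G → π k ∈Hᵗʳⁿ H C
      forth = ∈Hᵗʳⁿ-π (λ i → sym (πʰ-involutive (H C i)))
      forth-co : ∀ k → k ∈Hasco G → π k ∈Hasco H C
      forth-co = ∈Hasco-π (λ i → sym (πʰ-involutive (H C i)))
      back : ∀ k → ext (p k) ∈Hᵗʳⁿ H C → ext k ∈Hᵗʳⁿ G
      back k k∈ = transport (_∈Hᵗʳⁿ G) (π-involutive (ext k))
        (∈Hᵗʳⁿ-π {H C} (λ _ → refl) (ext (p k)) k∈)
      back-co : ∀ k → ext (p k) ∈Hasco H C → ext k ∈Hasco G
      back-co k k∈ = transport (_∈Hasco G) (π-involutive (ext k))
        (∈Hasco-π {H C} (λ _ → refl) (ext (p k)) k∈)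

    ≃-image : ∀ C {Q} (s : P C ∼ Q) → C ≃ image C s
    ≃-image C s = record { E-≃ = λ _ _ → mk⇔ id id ; H-≃ = λ _ → refl ; P-≃ = s }

    ♯Δ-π : ∀ {C D} → C ≃ D → ∀ k → k ♯Δ C → π k ♯Δ D
    ♯Δ-π {C} r k (k∉E , k∉H) =
      (λ k' e → k∉E (π k') (transport (λ l → E C l (π k')) (π-involutive k) (to (E-≃ r _ _) e))) ,
      (λ k∈ → k∉H (transport (_∈Hᵗʳⁿ H C) (π-involutive k)
        (∈Hᵗʳⁿ-π (H-≃ (≃-sym r)) (π k) k∈)))

    Apply-π : ∀ {σ R R'} → (∀ k k' → R k k' → R' (π k) (π k')) →
              ∀ {k k'} → Apply σ R k k' → Apply (πˢ σ) R' (π k) (π k')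
    Apply-π h (base e)         = base (h _ _ e)
    Apply-π {σ} h (target l∈)  = target (∈range-π σ l∈)
    Apply-π {σ} h (link k∈ l∈) = link (∈dom-π σ k∈) (∈range-π σ l∈)
    Apply-π h (symm a)         = symm (Apply-π h a)
    Apply-π h (transi a b)     = transi (Apply-π h a) (Apply-π h b)

    Apply-≃ : ∀ {C D} → C ≃ D → ∀ σ k k' →
              Apply (πˢ σ) (E D) k k' ⇔ Apply σ (E C) (π k) (π k')
    Apply-≃ {C} {D} r σ k k' = mk⇔
      (λ a → transport (λ σ' → Apply σ' (E C) (π k) (π k')) (πˢ-involutive σ)
        (Apply-π (λ l l' → to (E-≃ r l l')) a))
      (λ a → transport₂ (Apply (πˢ σ) (E D)) (π-involutive k) (π-involutive k')
        (Apply-π (λ l l' → to (E-≃ (≃-sym r) l l')) a))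

    Resolved-π : ∀ {R R' : Rel TrN 0ℓ} {s k h h'} → (∀ l l' → R' l l' ⇔ R (π l) (π l')) →
                 Resolved R s k h h' → Resolved R' s (π k) (πʰ h) (πʰ h')
    Resolved-π {R} {k = k} rel (change {k'} e) =
      change (from (rel _ _) (transport₂ R (sym (π-involutive (ext k'))) (sym (π-involutive k)) e))
    Resolved-π {R} {k = k} rel (keep h) =
      keep (λ k' a e e' → h (p k') a (πʰ-flip e)
        (transport (R (ext (p k'))) (π-involutive k) (to (rel _ _) e')))

    Extends-π : ∀ {G G' D D' : History} {k s} →
                (∀ i → D i ≡ πʰ (G i)) → (∀ i → D' i ≡ πʰ (G' i)) →
                Extends G (k , s) G' → Extends D (p k , s) D'
    Extends-π h h' (i , unused , used , others) =
      i , trans (h i) (cong πʰ unused) , trans (h' i) (cong πʰ used) ,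
      λ j j≢i → trans (h' j) (trans (cong πʰ (others j j≢i)) (sym (h j)))

    -- Configuration transitions under renaming.

    πᵉ : Event → Event
    πᵉ τ         = τ
    πᵉ (k ⟨ a ⟩) = p k ⟨ a ⟩
    -- For an involution, precomposition with `p` yields the image of `K` under `p`.
    πᵉ (co K)    = co (K ∘ p)

    module _ {C D : Config} (r : C ≃ D) (C' : Config) {Q} (s : P C' ∼ Q) where

      E-same : E C' ⇔ᴿ E C → E (image C' s) ⇔ᴿ E D
      E-same (f , g) = (λ e → from (E-≃ r _ _) (f e)) , (λ e → g (to (E-≃ r _ _) e))

      H-same : H C' ≗ H C → H (image C' s) ≗ H D
      H-same h i = trans (cong πʰ (h i)) (sym (H-≃ r i))

      E-Apply : ∀ σ → E C' ⇔ᴿ Apply σ (E C) → E (image C' s) ⇔ᴿ Apply (πˢ σ) (E D)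
      E-Apply σ (f , g) =
        (λ e → from (Apply-≃ r σ _ _) (f e)) , (λ e → g (to (Apply-≃ r σ _ _) e))

      Resolves-π : ∀ {st k} → Resolves C st k C' → Resolves D st (π k) (image C' s)
      Resolves-π {st} {k} (e , h) = E-same e , λ i →
        transport (λ x → Resolved (E D) st (π k) x (πʰ (H C' i))) (sym (H-≃ r i))
          (Resolved-π (E-≃ r) (h i))

    Eₑₓₜ-π : ∀ {C D} → C ≃ D → ∀ k k' → Eₑₓₜ D (π k) k' ⇔ Eₑₓₜ C k (p k')
    Eₑₓₜ-π {C} r k k' = mk⇔
      (λ e → transport (λ l → E C l (ext (p k'))) (π-involutive k) (to (E-≃ r _ _) e))
      (λ e → from (E-≃ r _ _) (transport (λ l → E C l (ext (p k'))) (sym (π-involutive k)) e))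

    process-ok : ∀ C → Subterms-ok (P C)
    process-ok C = proj₂ (proj₂ (P-process C))

    ≃-step : ∀ {C D C' ζ} → C ≃ D → C —[ ζ ]→c C' →
             ∃ λ D' → (D —[ πᵉ ζ ]→c D') × C' ≃ D'
    ≃-step {C' = C'} r (τ-plain u e h) =
      let (_ , u' , s) = ∼-step (P-≃ r) u
      in image C' s , τ-plain u' (E-same r C' s e) (H-same r C' s h) , ≃-image C' s
    ≃-step {C' = C'} r (τ-tr {k = k} {σ} u k♯ e h) =
      let (_ , u' , s) = ∼-step (P-≃ r) u
      in image C' s , τ-tr u' (♯Δ-π r (int k) k♯) (E-Apply r C' s σ e) (H-same r C' s h) ,
         ≃-image C' s
    ≃-step {C} {C' = C'} r (τ-new {k = k} u k♯ e h) =
      let (_ , u' , s) = ∼-reconf (process-ok C) (P-≃ r) u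
      in image C' s , τ-new u' (♯Δ-π r (int k) k♯) (E-same r C' s e) (H-same r C' s h) ,
         ≃-image C' s
    ≃-step {C} {C' = C'} r (co-ext {k = k} u (f , g) (l , l∈) h) =
      let (_ , u' , s) = ∼-reconf (process-ok C) (P-≃ r) u
      in image C' s ,
         co-ext u' ((λ x → from (Eₑₓₜ-π r k _) (f x)) , (λ x → g (to (Eₑₓₜ-π r k _) x)))
           (p l , from (Eₑₓₜ-π r k (p l)) (transport (Eₑₓₜ C k) (sym (p-involutive l)) l∈))
           (Resolves-π r C' s h) ,
         ≃-image C' s
    ≃-step {C} {C' = C'} r (co-int {k = k} u none h) =
      let (_ , u' , s) = ∼-reconf (process-ok C) (P-≃ r) u
      in image C' s ,
         co-int u' (λ k' x → none (p k') (to (Eₑₓₜ-π r k k') x)) (Resolves-π r C' s h) ,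
         ≃-image C' s
    ≃-step {C} {C' = C'} r (τ-ab u h) =
      let (_ , u' , s) = ∼-reconf (process-ok C) (P-≃ r) u
      in image C' s , τ-ab u' (Resolves-π r C' s h) , ≃-image C' s
    ≃-step {C' = C'} r (visible {k = k} {σ = σ} u k♯ e h) =
      let (_ , u' , s) = ∼-step (P-≃ r) u
      in image C' s ,
         visible u' (♯Δ-π r (ext k) k♯) (E-Apply r C' s σ e) (Extends-π (H-≃ r) (λ _ → refl) h) ,
         ≃-image C' s
    ≃-step {C} {D} {C'} r (idle {k = k} P≡ k♯ (f , g) h) =
      image C' s ,
      idle refl (♯Δ-π r (ext k) k♯)
        ((λ e → Sum.map (from (E-≃ r _ _)) (Product.map flip flip) (f e)) ,
         (λ e → g (Sum.map (to (E-≃ r _ _)) (Product.map unflip unflip) e)))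
        (Extends-π (H-≃ r) (λ _ → refl) h) ,
      ≃-image C' s
      where
      -- An idle step leaves the process alone, so `P D` itself serves as the process of the target.
      s : P C' ∼ P D
      s = transport (_∼ P D) (sym P≡) (P-≃ r)
      flip : ∀ {l} → π l ≡ ext k → l ≡ ext (p k)
      flip {l} e = trans (sym (π-involutive l)) (cong π e)
      unflip : ∀ {l} → l ≡ ext (p k) → π l ≡ ext k
      unflip e = trans (cong π e) (π-involutive (ext k))

    ≃-⇒τ : ∀ {C D C'} → C ≃ D → C ⇒τ C' → ∃ λ D' → (D ⇒τ D') × C' ≃ D'
    ≃-⇒τ r done    = _ , done , r
    ≃-⇒τ r (t ◅ w) =
      let (_ , t' , r') = ≃-step r t ; (_ , w' , r'') = ≃-⇒τ r' w in _ , t' ◅ w' , r''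

    ≃-weak : ∀ ζ {C D C'} → C ≃ D → C =[ ζ ]⇒c C' →
             ∃ λ D' → (D =[ πᵉ ζ ]⇒c D') × C' ≃ D'
    ≃-weak τ r w = ≃-⇒τ r w
    ≃-weak (k ⟨ a ⟩) r (_ , _ , pre , t , post) =
      let (_ , pre' , r₁) = ≃-⇒τ r pre ; (_ , t' , r₂) = ≃-step r₁ t
          (_ , post' , r₃) = ≃-⇒τ r₂ post
      in _ , (_ , _ , pre' , t' , post') , r₃
    ≃-weak (co K) r (_ , _ , pre , t , post) =
      let (_ , pre' , r₁) = ≃-⇒τ r pre ; (_ , t' , r₂) = ≃-step r₁ t
          (_ , post' , r₃) = ≃-⇒τ r₂ post
      in _ , (_ , _ , pre' , t' , post') , r₃

    -- Satisfaction under renaming.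

    instantiate-π : ∀ {n} {A : Pred ExTrN 0ℓ} {ρ ρ' : Env n} {K} →
                    (∀ {k} → A k → p k ≡ k) → (∀ x → ρ' x ≡ p (ρ x)) →
                    (∀ k → K (inj₁ k) → A k) →
                    (instantiate ρ K ∘ p) ≐ instantiate ρ' K
    instantiate-π fixed h over =
      (λ { (inj₁ k , k∈ , e) →
             inj₁ k , k∈ , trans (sym (fixed (over k k∈))) (trans (cong p e) (p-involutive _))
         ; (inj₂ x , x∈ , e) → inj₂ x , x∈ , trans (h x) (trans (cong p e) (p-involutive _)) }) ,
      (λ { (inj₁ k , k∈ , refl) → inj₁ k , k∈ , sym (fixed (over k k∈))
         ; (inj₂ x , x∈ , refl) →
             inj₂ x , x∈ , trans (sym (p-involutive _)) (cong p (sym (h x))) })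

    -- With all constants fixed by `p`, the renaming acts on a commit set only through the values of
    -- its variables. It is therefore absorbed by the environment, and the formula stays the same.
    ⊨-π : ∀ {n A} {ρ ρ' : Env n} → (∀ {k} → A k → p k ≡ k) → (∀ x → ρ' x ≡ p (ρ x)) →
          ∀ (φ : Formula n) → Over A φ → ∀ {C D} → C ≃ D → ρ ⊢ C ⊨ φ → ρ' ⊢ D ⊨ φ
    ⊨-π fixed h (⟨τ⟩ φ) o r (C' , w , sat) =
      let (D' , w' , r') = ≃-weak τ r w in D' , w' , ⊨-π fixed h φ o r' sat
    ⊨-π fixed h (⟨x a ⟩ φ) o {D = D} r (N , (ks , all) , f) =
      -- A step of `D` with name `l` comes from a step of `C` with name `p l`, so the cofinite set
      -- is pulled back along `p`.
      N ∘ p ,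
      (map p ks , λ k k∉ → transport (_∈ map p ks) (p-involutive k) (∈-map⁺ p (all (p k) k∉))) ,
      λ l l∈ →
        let (C' , w , sat) = f (p l) l∈ ; (D' , w' , r') = ≃-weak (p l ⟨ a ⟩) r w
        in D' , transport (λ k → D =[ k ⟨ a ⟩ ]⇒c D') (p-involutive l) w' ,
           ⊨-π fixed (λ { Fin.zero → sym (p-involutive l) ; (Fin.suc x) → h x }) φ o r' sat
    -- Negation reverses the direction, which requires exchanging the two configurations and the two
    -- environments.
    ⊨-π {ρ = ρ} {ρ'} fixed h (¬' φ) o r ¬sat sat =
      ¬sat (⊨-π fixed (λ x → trans (sym (p-involutive (ρ x))) (cong p (sym (h x)))) φ o (≃-sym r) sat)
    ⊨-π fixed h (⋀ φ) o r sat i = ⊨-π fixed h (φ i) (o i) r (sat i)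
    ⊨-π fixed h (⟨co K ≢∅ _ ⟩ φ) (over , o) r (C' , w , sat) =
      let (D' , w' , r') = ≃-weak (co _) r w
      in D' , co-respects-≐ (instantiate-π fixed h over) w' , ⊨-π fixed h φ o r' sat

  -- External names along transitions

  -- The history holds every external name of a configuration: those in `E` by `E-dom`, those in the
  -- process by `P-external`.
  Named : Config → Pred ExTrN 0ℓ
  Named C k = ext k ∈Hᵗʳⁿ H C

  unnamed⇒♯ : ∀ C {k} → ¬ Named C k → ext k ♯ C
  unnamed⇒♯ C {k} k∉ =
    ((λ k' e → k∉ (to (E-dom C k) (trans-E e (sym-E e)))) , k∉) , k∉ ∘ P-external C k
    where open IsPartialEquivalence (E-equiv C) renaming (sym to sym-E; trans to trans-E)

  -- By `E-dom` these names are the external part of the domain of `E`, which is finite.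
  Finite-Named : ∀ C → Finite (Named C)
  Finite-Named C = let (ks , all) = E-finite C in
    externals ks , λ k k∈ → ∈-externals (all (ext k) (from (E-dom C k) k∈))
    where
    externals : List TrN → List ExTrN
    externals []           = []
    externals (int _ ∷ ks) = externals ks
    externals (ext k ∷ ks) = k ∷ externals ks
    ∈-externals : ∀ {k ks} → ext k ∈ ks → k ∈ externals ks
    ∈-externals {ks = ext _ ∷ _} (here refl) = here refl
    ∈-externals {ks = int _ ∷ _} (there k∈)  = ∈-externals k∈
    ∈-externals {ks = ext _ ∷ _} (there k∈)  = there (∈-externals k∈)

  infix 4 _≐Named_
  _≐Named_ : Config → Config → Set
  C ≐Named C' = ∀ k → Named C k ⇔ Named C' k

  ≐Named-trans : ∀ C D C' → C ≐Named D → D ≐Named C' → C ≐Named C'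
  ≐Named-trans _ _ _ f g k = mk⇔ (to (g k) ∘ to (f k)) (from (f k) ∘ from (g k))

  ≗⇒Named : ∀ C C' → H C' ≗ H C → C ≐Named C'
  ≗⇒Named _ _ h k = mk⇔
    (λ (i , s , e) → i , s , trans (h i) e) (λ (i , s , e) → i , s , trans (sym (h i)) e)

  -- Resolution may change the status stored at an index, but never the name.
  Resolves⇒Named : ∀ C {s k} C' → Resolves C s k C' → C ≐Named C'
  Resolves⇒Named _ _ (_ , h) l = mk⇔
    (λ (i , s , e) → i , forth (h i) e) (λ (i , s , e) → i , back (h i) e)
    where
    forth : ∀ {R s k x y t} → Resolved R s k x y → x ≡ just (l , t) → ∃ λ t' → y ≡ just (l , t')
    forth (change _) refl = _ , refl
    forth (keep _) e      = _ , e
    back : ∀ {R s k x y t} → Resolved R s k x y → y ≡ just (l , t) → ∃ λ t' → x ≡ just (l , t')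
    back (change _) refl = _ , refl
    back (keep _) e      = _ , e

  τ-Named : ∀ {C C'} → C —[ τ ]→c C' → C ≐Named C'
  τ-Named {C} {C'} (τ-plain _ _ h) = ≗⇒Named C C' h
  τ-Named {C} {C'} (τ-tr _ _ _ h)  = ≗⇒Named C C' h
  τ-Named {C} {C'} (τ-new _ _ _ h) = ≗⇒Named C C' h
  τ-Named {C} {C'} (co-int _ _ h)  = Resolves⇒Named C C' h
  τ-Named {C} {C'} (τ-ab _ h)      = Resolves⇒Named C C' h

  ⇒τ-Named : ∀ {C C'} → C ⇒τ C' → C ≐Named C'
  ⇒τ-Named done k    = mk⇔ id id
  ⇒τ-Named {C} {C'} (_◅_ {j = D} t w) =
    ≐Named-trans C D C' (τ-Named t) (⇒τ-Named w)

  =co⇒-Named : ∀ {C C' K} → C =[ co K ]⇒c C' → C ≐Named C'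
  =co⇒-Named {C} {C'} (D , D' , pre , co-ext _ _ _ h , post) =
    ≐Named-trans C D C' (⇒τ-Named pre)
      (≐Named-trans D D' C' (Resolves⇒Named D D' h) (⇒τ-Named post))

  -- The committed set lies in the domain of `E` just before the commit, and the preceding silent
  -- steps do not change the external names. Hence the set can be described with names available at
  -- the source.
  =co⇒-⊆Named : ∀ {C C' K} → C =[ co K ]⇒c C' → ∀ k → K k → Named C k
  =co⇒-⊆Named (D , _ , pre , co-ext _ (f , _) _ _ , _) k k∈ =
    from (⇒τ-Named pre k) (to (E-dom D k) (trans-E (sym-E (f k∈)) (f k∈)))
    where open IsPartialEquivalence (E-equiv D) renaming (sym to sym-E; trans to trans-E)

  =co⇒-nonempty : ∀ {C C' K} → C =[ co K ]⇒c C' → ∃ K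
  =co⇒-nonempty (_ , _ , _ , co-ext _ (_ , g) (l , l∈) _ , _) = l , g l∈

  Extends-Named : ∀ C C' {k s} → Extends (H C) (k , s) (H C') →
                  ∀ l → Named C' l ⇔ (l ≡ k ⊎ Named C l)
  Extends-Named C C' {k} (i , unused , used , others) l = mk⇔ forth back
    where
    forth : Named C' l → l ≡ k ⊎ Named C l
    forth (j , s , e) with via-injection I-countable ℕ._≟_ j i
    ... | yes refl = inj₁ (cong proj₁ (just-injective (trans (sym e) used)))
    ... | no j≢i   = inj₂ (j , s , trans (sym (others j j≢i)) e)
    back : l ≡ k ⊎ Named C l → Named C' l
    back (inj₁ refl)        = i , _ , used
    back (inj₂ (j , s , e)) =
      j , s , trans (others j λ { refl → case trans (sym unused) e of λ () }) e

  visible-Named : ∀ {C C' k a} → C —[ k ⟨ a ⟩ ]→c C' →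
                  ¬ Named C k × (∀ l → Named C' l ⇔ (l ≡ k ⊎ Named C l))
  visible-Named {C} {C'} (visible _ (_ , k∉) _ h) = k∉ , Extends-Named C C' h
  visible-Named {C} {C'} (idle _ (_ , k∉) _ h)    = k∉ , Extends-Named C C' h

  =visible⇒-Named : ∀ {C C' k a} → C =[ k ⟨ a ⟩ ]⇒c C' →
                    ¬ Named C k × (∀ l → Named C' l ⇔ (l ≡ k ⊎ Named C l))
  =visible⇒-Named {k = k} (_ , _ , pre , t , post) =
    let (k∉ , h) = visible-Named t in
    k∉ ∘ to (⇒τ-Named pre k) ,
    λ l → mk⇔
      (Sum.map₂ (from (⇒τ-Named pre l)) ∘ to (h l) ∘ from (⇒τ-Named post l))
      (to (⇒τ-Named post l) ∘ from (h l) ∘ Sum.map₂ (to (⇒τ-Named pre l)))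

  module _ (p : ExTrN → ExTrN) (p-involutive : ∀ k → p (p k) ≡ k) where
    open Renaming p p-involutive

    -- An involution that fixes the names in the history fixes all external names of `C`.
    -- Transitions out of `C` can then be renamed while their source stays put.
    ≃-fixed : ∀ C → (∀ {k} → Named C k → p k ≡ k) → C ≃ C
    ≃-fixed C fixed = record
      { E-≃ = λ k k' → mk⇔ forth
          (λ e → transport₂ (E C) (π-involutive k) (π-involutive k') (forth e))
      ; H-≃ = λ i → H-fixed (H C i) refl
      ; P-≃ = ∼-fixed (P C) λ { (int k) _ → refl ; (ext k) k∈ → cong ext (fixed (P-external C k k∈)) }
      }
      where
      open IsPartialEquivalence (E-equiv C) renaming (sym to sym-E; trans to trans-E)
      E-fixed : ∀ k → E C k k → π k ≡ k
      E-fixed (int k) _ = refl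
      E-fixed (ext k) e = cong ext (fixed (to (E-dom C k) e))
      forth : ∀ {k k'} → E C k k' → E C (π k) (π k')
      -- Both ends of a related pair are related to themselves, so they lie in the domain of `E` and
      -- are fixed.
      forth e = transport₂ (E C) (sym (E-fixed _ (trans-E e (sym-E e))))
        (sym (E-fixed _ (trans-E (sym-E e) e))) e
      H-fixed : ∀ {i} h → H C i ≡ h → h ≡ πʰ h
      H-fixed nothing _        = refl
      H-fixed (just (k , s)) e = cong (λ l → just (l , s)) (sym (fixed (_ , s , e)))

  -- Soundness and completeness

  module Classical (em : ExcludedMiddle (suc (suc 0ℓ))) where

    em₀ : ExcludedMiddle 0ℓ
    em₀ = map′ Level.lower Level.lift (em {Lift _ _})

    dne₀ : {A : Set} → ¬ ¬ A → A
    dne₀ = em⇒dne em₀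

    dne₁ : {A : Set₁} → ¬ ¬ A → A
    dne₁ = em⇒dne (map′ Level.lower Level.lift (em {Lift _ _}))

    module _ where
      open Simulates

      -- The two simulations are separate arguments so that the case of negation can exchange them.
      sound : ∀ {R n} {ρ : Env n} → Simulates R → Simulates (λ C D → R D C) →
              ∀ φ {C D} → R C D → ρ ⊢ C ⊨ φ → ρ ⊢ D ⊨ φ
      sound sim sim' (⟨τ⟩ φ) r (C' , w , sat) =
        let (D' , w' , r') = on-τ sim r w in D' , w' , sound sim sim' φ r' sat
      sound sim sim' (⟨x a ⟩ φ) {D = D} r (N , (ks , all) , f) =
        (λ l → N l × ¬ Named D l) , (ks ++ ls , cofinite) ,
        λ l (l∈ , l∉) →
          let (C' , w , sat) = f l l∈
              (D' , w' , r') = on-act sim r w (unnamed⇒♯ D l∉)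
          in D' , w' , sound sim sim' φ r' sat
        where
        ls = proj₁ (Finite-Named D)
        cofinite : ∀ l → ¬ (N l × ¬ Named D l) → l ∈ ks ++ ls
        cofinite l l∉ with em₀ {N l}
        ... | no  ¬n = ∈-++⁺ˡ (all l ¬n)
        ... | yes n  = ∈-++⁺ʳ ks (proj₂ (Finite-Named D) l (dne₀ (l∉ ∘ (n ,_))))
      sound {R} sim sim' (¬' φ) r ¬sat sat =
        ¬sat (sound {λ C D → R D C} sim' sim φ r sat)
      sound sim sim' (⋀ φ) r sat i = sound sim sim' (φ i) r (sat i)
      sound sim sim' (⟨co K ≢∅ _ ⟩ φ) r (C' , w , sat) =
        let (D' , w' , r') = on-co sim r w in D' , w' , sound sim sim' φ r' sat

    -- Refinement by formulas over a set of constants.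

    module Completeness (A : Pred ExTrN 0ℓ) where

      Refines : ∀ {n} → Env n → Config → Config → Set₂
      Refines ρ C D = ∀ φ → Over A φ → ρ ⊢ C ⊨ φ → ρ ⊢ D ⊨ φ

      -- Formulas over `A` are closed under negation, so refinement is already an equivalence.
      Refines-sym : ∀ {n} {ρ : Env n} {C D} → Refines ρ C D → Refines ρ D C
      Refines-sym ref φ o sat = dne₁ λ ¬sat → ref (¬' φ) o ¬sat sat

      -- Characteristic formulas.

      module _ {n} (ρ : Env n) (C : Config) where

        Separable : Config → Set₂
        Separable D = ∃ λ φ → Over A φ × (ρ ⊢ C ⊨ φ) × ¬ (ρ ⊢ D ⊨ φ)

        choose : ∀ {D} → Dec (Separable D) → Formula n
        choose (yes (φ , _)) = φ
        -- The empty conjunction, which always holds: nothing has to be separated.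
        choose (no _)        = ⋀ {M = Lift _ ⊥} λ ()

        characteristic : Formula n
        characteristic = ⋀ λ D → choose (em {Separable D})

        characteristic-Over : Over A characteristic
        characteristic-Over D with em {Separable D}
        ... | yes (_ , o , _) = o
        ... | no _            = λ ()

        characteristic-sat : ρ ⊢ C ⊨ characteristic
        characteristic-sat D with em {Separable D}
        ... | yes (_ , _ , sat , _) = sat
        ... | no _                  = λ ()

        -- The conjunct indexed by `D` itself decides: if `D` were separable, it would satisfy the
        -- very formula that separates it.
        characteristic⇒Refines : ∀ {D} → ρ ⊢ D ⊨ characteristic → Refines ρ C D
        characteristic⇒Refines {D} sat with em {Separable D} | sat D
        ... | yes (_ , _ , _ , ¬sat) | sat' = contradiction sat' ¬sat
        ... | no ¬sep                | _    = λ φ o sat' → dne₁ λ ¬sat → ¬sep (φ , o , sat' , ¬sat)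

      -- Agreement of configurations.

      Known : ∀ {n} → Env n → Pred ExTrN 0ℓ
      Known ρ k = A k ⊎ ∃ λ x → ρ x ≡ k

      -- Both directions of `names` matter. That named implies known lets commit sets be written as
      -- formulas and lets swaps of unknown names fix the configurations. That known implies named
      -- keeps the known names finite and makes the name of a fresh visible step unknown.
      record Agree (C D : Config) : Set₂ where
        constructor agree
        field
          {size}  : ℕ
          ρ       : Env size
          names   : ∀ k → Known ρ k ⇔ (Named C k ⊎ Named D k)
          refines : Refines ρ C D

      Agree-sym : ∀ {C D} → Agree C D → Agree D C
      Agree-sym (agree ρ names ref) =
        agree ρ (λ k → mk⇔ (Sum.swap ∘ to (names k)) (from (names k) ∘ Sum.swap)) (Refines-sym ref)

      -- As `k` and `l` are both unknown, their transposition fixes `C`, the constants in `A` and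
      -- all values of `ρ`; only the new variable moves from `k` to `l`.
      fresh-instance : ∀ {n} (ρ : Env n) (φ : Formula (ℕ.suc n)) {C C' k l a} →
        (∀ j → Named C j → Known ρ j) → ¬ Known ρ k → ¬ Known ρ l → Over A φ →
        C =[ k ⟨ a ⟩ ]⇒c C' → ρ ▸ k ⊢ C' ⊨ φ →
        ∃ λ C'' → (C =[ l ⟨ a ⟩ ]⇒c C'') × (ρ ▸ l ⊢ C'' ⊨ φ)
      fresh-instance ρ φ {C} {k = k} {l} {a} known k∉ l∉ o w sat =
        let (C'' , w' , r) = ≃-weak (k ⟨ a ⟩) (≃-fixed swap swap-involutive C (fixed ∘ known _)) w
        in C'' , transport (λ j → C =[ j ⟨ a ⟩ ]⇒c C'') swap-left w' ,
           ⊨-π (fixed ∘ inj₁)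
             (λ { Fin.zero → sym swap-left ; (Fin.suc x) → sym (fixed (inj₂ (x , refl))) })
             φ o r sat
        where
        open Transposition _≟ᵉ_ k l
        open Renaming swap swap-involutive
        fixed : ∀ {j} → Known ρ j → swap j ≡ j
        fixed j∈ = swap-other (λ { refl → k∉ j∈ }) (λ { refl → l∉ j∈ })

      Known-finite : ∀ {C D} (r : Agree C D) → Finite (Known (Agree.ρ r))
      Known-finite {C} {D} (agree ρ names _) =
        let (ks , k-all) = Finite-Named C ; (ls , l-all) = Finite-Named D in
        ks ++ ls , λ k k∈ →
          [ ∈-++⁺ˡ ∘ k-all k , ∈-++⁺ʳ ks ∘ l-all k ]′ (to (names k) k∈)

      -- Silent and commit steps introduce no external name, so the environment can be kept.
      Agree-≐Named : ∀ {C D C' D'} (r : Agree C D) → C ≐Named C' → D ≐Named D' →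
                     Refines (Agree.ρ r) C' D' → Agree C' D'
      Agree-≐Named (agree ρ names _) f g ref = agree ρ
        (λ k → mk⇔ (Sum.map (to (f k)) (to (g k)) ∘ to (names k))
                   (from (names k) ∘ Sum.map (from (f k)) (from (g k))))
        ref

      -- Agreement is matched along each kind of weak transition.

      Agree-τ : ∀ {C D C'} → Agree C D → C ⇒τ C' → ∃ λ D' → (D ⇒τ D') × Agree C' D'
      Agree-τ {C' = C'} r@(agree ρ _ ref) w =
        let (D' , w' , sat) = ref (⟨τ⟩ characteristic ρ C') (characteristic-Over ρ C')
                                (C' , w , characteristic-sat ρ C')
        in D' , w' , Agree-≐Named r (⇒τ-Named w) (⇒τ-Named w') (characteristic⇒Refines ρ C' sat)

      Agree-co : ∀ {C D C' K} → Agree C D → C =[ co K ]⇒c C' →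
                 ∃ λ D' → (D =[ co K ]⇒c D') × Agree C' D'
      Agree-co {C' = C'} {K} r@(agree ρ names ref) w =
        let (D' , w' , sat) =
              ref (⟨co K' ≢∅ nonempty ⟩ characteristic ρ C')
                ((λ _ → proj₂) , characteristic-Over ρ C')
                (C' , co-respects-≐ (Product.swap instance-K') w , characteristic-sat ρ C')
            w'' = co-respects-≐ instance-K' w'
        in D' , w'' ,
           Agree-≐Named r (=co⇒-Named w) (=co⇒-Named w'') (characteristic⇒Refines ρ C' sat)
        where
        -- Names of `K` outside `A` may not occur as constants; they are represented by the
        -- variables that `ρ` sends into `K`.
        K' : Pred (ExTrN ⊎ Fin _) 0ℓ
        K' (inj₁ k) = K k × A k
        K' (inj₂ x) = K (ρ x)
        instance-K' : instantiate ρ K' ≐ K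
        instance-K' =
          (λ { (inj₁ k , (k∈ , _) , refl) → k∈ ; (inj₂ x , k∈ , refl) → k∈ }) ,
          λ {k} k∈ → case from (names k) (inj₁ (=co⇒-⊆Named w k k∈)) of λ
            { (inj₁ a) → inj₁ k , (k∈ , a) , refl ; (inj₂ (x , refl)) → inj₂ x , k∈ , refl }
        nonempty : ∃ K'
        nonempty = let (k , k∈) = =co⇒-nonempty w ; (z , z∈ , _) = proj₂ instance-K' k∈ in z , z∈

      Agree-act : ∀ {C D C' k a} → Agree C D → C =[ k ⟨ a ⟩ ]⇒c C' → ext k ♯ D →
                  ∃ λ D' → (D =[ k ⟨ a ⟩ ]⇒c D') × Agree C' D'
      Agree-act {C} {D} {C'} {k} {a} r@(agree ρ names ref) w ((_ , k∉D) , _) =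
        let (N , (ks , all) , f) = ref (⟨x a ⟩ φ) o C-sat
            (ls , all') = Known-finite r
            -- The name `l` avoids both the exceptions to `N` and all known names.
            (l , l∉) = ExTrN-infinite (ks ++ ls)
            (_ , v , sat) = f l (dne₀ (l∉ ∘ ∈-++⁺ˡ ∘ all l))
            -- Here the swap runs from the auxiliary name `l` back to the name `k` of the given
            -- step.
            (D' , v' , sat') = fresh-instance ρ φ (λ j → from (names j) ∘ inj₂)
                                 (l∉ ∘ ∈-++⁺ʳ ks ∘ all' l) k∉ o v sat
        in D' , v' ,
           agree (ρ ▸ k)
             (λ j → mk⇔
               (λ { (inj₁ j∈)               → extend w v' j (inj₂ (inj₁ j∈))
                  ; (inj₂ (Fin.zero , refl)) → extend w v' j (inj₁ refl)
                  ; (inj₂ (Fin.suc x , e))   → extend w v' j (inj₂ (inj₂ (x , e))) })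
               [ restrict ∘ Sum.map₂ (from (names j) ∘ inj₁) ∘ to (proj₂ (=visible⇒-Named w) j)
               , restrict ∘ Sum.map₂ (from (names j) ∘ inj₂) ∘ to (proj₂ (=visible⇒-Named v') j) ]′)
             (characteristic⇒Refines (ρ ▸ k) C' sat')
        where
        φ = characteristic (ρ ▸ k) C'
        o = characteristic-Over (ρ ▸ k) C'
        k∉ : ¬ Known ρ k
        k∉ = [ proj₁ (=visible⇒-Named w) , k∉D ]′ ∘ to (names k)
        C-sat : ρ ⊢ C ⊨ ⟨x a ⟩ φ
        C-sat =
          -- All unknown names witness the modality, since the swap carries the given step from `k`
          -- to each of them.
          (¬_ ∘ Known ρ) ,
          (proj₁ (Known-finite r) , λ l l∈ → proj₂ (Known-finite r) l (dne₀ l∈)) ,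
          λ l l∉ → fresh-instance ρ φ (λ j → from (names j) ∘ inj₁) k∉ l∉ o w
                     (characteristic-sat (ρ ▸ k) C')
        extend : ∀ {D'} → C =[ k ⟨ a ⟩ ]⇒c C' → D =[ k ⟨ a ⟩ ]⇒c D' →
                 ∀ j → j ≡ k ⊎ Known ρ j → Named C' j ⊎ Named D' j
        extend u v j (inj₁ j≡k) = inj₁ (from (proj₂ (=visible⇒-Named u) j) (inj₁ j≡k))
        extend u v j (inj₂ j∈)  =
          Sum.map (from (proj₂ (=visible⇒-Named u) j) ∘ inj₂)
                  (from (proj₂ (=visible⇒-Named v) j) ∘ inj₂) (to (names j) j∈)
        restrict : ∀ {j} → j ≡ k ⊎ Known ρ j → Known (ρ ▸ k) j
        restrict (inj₁ refl)           = inj₂ (Fin.zero , refl)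
        restrict (inj₂ (inj₁ j∈))      = inj₁ j∈
        restrict (inj₂ (inj₂ (x , e))) = inj₂ (Fin.suc x , e)

      -- Agreement quantifies over formulas, hence lives one universe above the
      -- relations that bisimilarity ranges over; excluded middle lowers it.
      Agree₁ : Config → Config → Set₁
      Agree₁ C D = Lift _ (True (em {Agree C D}))

      lower₁ : ∀ {C D} → Agree₁ C D → Agree C D
      lower₁ = toWitness ∘ Level.lower

      lift₁ : ∀ {C D} → Agree C D → Agree₁ C D
      lift₁ = Level.lift ∘ fromWitness

      Agree-simulates : Simulates Agree₁
      Agree-simulates = record
        { on-τ   = λ r w → let (D' , w' , r') = Agree-τ (lower₁ r) w in D' , w' , lift₁ r'
        ; on-act = λ r w k♯ → let (D' , w' , r') = Agree-act (lower₁ r) w k♯ in D' , w' , lift₁ r'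
        ; on-co  = λ r w → let (D' , w' , r') = Agree-co (lower₁ r) w in D' , w' , lift₁ r'
        }

      Agree-simulates˘ : Simulates (λ C D → Agree₁ D C)
      Agree-simulates˘ = record
        { on-τ   = λ r w →
            let (D' , w' , r') = Agree-τ (Agree-sym (lower₁ r)) w
            in D' , w' , lift₁ (Agree-sym r')
        ; on-act = λ r w k♯ →
            let (D' , w' , r') = Agree-act (Agree-sym (lower₁ r)) w k♯
            in D' , w' , lift₁ (Agree-sym r')
        ; on-co  = λ r w →
            let (D' , w' , r') = Agree-co (Agree-sym (lower₁ r)) w
            in D' , w' , lift₁ (Agree-sym r')
        }

    complete : ∀ {C₁ C₂} → 𝓛Canco C₁ ≐ 𝓛Canco C₂ → C₁ ≈Canco C₂
    complete {C₁} {C₂} (f , _) =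
      Agree₁ , (Agree-simulates , Agree-simulates˘) ,
      -- At the start every external name of the two configurations is a constant and the
      -- environment is empty; it grows only with visible steps.
      lift₁ (agree ∅ (λ k → mk⇔ [ id , (λ ()) ]′ inj₁) (λ φ _ → f))
      where open Completeness (λ k → Named C₁ k ⊎ Named C₂ k)

proposition4p14 : ExcludedMiddle (suc (suc 0ℓ)) → (S : Signature) → let open Calculus S in (C₁ C₂ : Config) → (C₁ ≈Canco C₂) ⇔ (𝓛Canco C₁ ≐ 𝓛Canco C₂)
proposition4p14 em S C₁ C₂ = mk⇔
  (λ (R , (sim , sim˘) , r) → (λ {φ} → sound sim sim˘ φ r) , (λ {φ} → sound sim˘ sim φ r))
  complete
  where open Classical S em
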